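{- (a) For $n\ge 2$, $\overrightarrow{trc}(\overleftrightarrow{P_n})=\overrightarrow{strc}(\overleftrightarrow{P_n})=2n-3$. (b) For $n\ge 3$, $\overrightarrow{trc}(\overleftrightarrow{C_n})=\overrightarrow{strc}(\overleftrightarrow{C_n})=g(n)$, where $g(n)=n-2$ if $n\in\{3,5\}$; $g(n)=n-1$ if $n\in\{4,6,7,8,9,10,12\}$; and $g(n)=n$ if $n=11$ or $n\ge 13$. (c) For $n\ge 4$, $\overrightarrow{trc}(\overleftrightarrow{W_n})=\overrightarrow{strc}(\overleftrightarrow{W_n})=3$. (d) Let $t\ge 2$ and let $\overleftrightarrow{K_{n_1,\dots,n_t}}$ be the biorientation of a complete $t$-partite graph with $n_i\ge 2$ for some $i$. Then $\overrightarrow{trc}(\overleftrightarrow{K_{n_1,\dots,n_t}})=\overrightarrow{strc}(\overleftrightarrow{K_{n_1,\dots,n_t}})=3$.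
   Context: The biorientation $\overleftrightarrow{G}$ of a graph $G$ replaces each edge $uv$ by the two arcs $uv$ and $vu$. $P_n$ and $C_n$ are the (undirected) path and cycle on $n$ vertices; for $n\ge 3$ the wheel $W_n$ is obtained from $C_n$ by adding a new vertex adjacent to every vertex of $C_n$; $K_{n_1,\dots,n_t}$ is the complete $t$-partite graph with class sizes $n_1,\dots,n_t$. For a strongly connected digraph $D$: a directed path is total-rainbow if its arcs and internal vertices all receive pairwise distinct colours under a total-colouring (colouring of vertices and arcs); $\overrightarrow{trc}(D)$ (resp. $\overrightarrow{strc}(D)$) is the minimum number of colours in a total-colouring such that every ordered pair $(u,v)$ of vertices is joined by a total-rainbow directed $u$–$v$ path (resp. total-rainbow shortest directed $u$–$v$ path). -}

module Defs where

open import Data.Nat using (ℕ; zero; suc; _+_; _*_; _∸_; _≤_)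
open import Data.Fin using (Fin; toℕ)
open import Data.Maybe using (Maybe; just; nothing)
open import Data.Product using (Σ; _×_; _,_; ∃-syntax)
open import Data.Sum using (_⊎_)
open import Data.Empty using (⊥)
open import Data.Unit using (⊤)
open import Data.List using (List; []; _∷_; _++_; map)
open import Data.List.Relation.Unary.Unique.Propositional using (Unique)
open import Relation.Binary.PropositionalEquality using (_≡_; _≢_)

-- An (undirected) graph: vertex type and a (symmetric, irreflexive)
-- adjacency relation.
record Graph : Set₁ where
  field
    V   : Set
    adj : V → V → Set

record Digraph : Set₁ where
  field
    V   : Set
    arc : V → V → Set

biorient : Graph → Digraph
biorient G = record { V = Graph.V G ; arc = λ u v → Graph.adj G u v ⊎ Graph.adj G v u }

pathAdj : (n : ℕ) → Fin n → Fin n → Set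
pathAdj n i j = (suc (toℕ i) ≡ toℕ j) ⊎ (suc (toℕ j) ≡ toℕ i)

P : ℕ → Graph
P n = record { V = Fin n ; adj = pathAdj n }

cycleAdj : (n : ℕ) → Fin n → Fin n → Set
cycleAdj n i j = pathAdj n i j
  ⊎ ((toℕ i ≡ 0 × toℕ j ≡ n ∸ 1) ⊎ (toℕ j ≡ 0 × toℕ i ≡ n ∸ 1))

C : ℕ → Graph
C n = record { V = Fin n ; adj = cycleAdj n }

wheelAdj : (n : ℕ) → Maybe (Fin n) → Maybe (Fin n) → Set
wheelAdj n nothing  nothing  = ⊥
wheelAdj n nothing  (just _) = ⊤
wheelAdj n (just _) nothing  = ⊤
wheelAdj n (just i) (just j) = cycleAdj n i j

W : ℕ → Graph
W n = record { V = Maybe (Fin n) ; adj = wheelAdj n }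

K : (t : ℕ) → (Fin t → ℕ) → Graph
K t ns = record
  { V   = Σ (Fin t) (λ i → Fin (ns i))
  ; adj = λ { (i , _) (j , _) → i ≢ j } }

module _ (D : Digraph) where
  open Digraph D

  data Path : V → V → Set where
    []  : ∀ {u} → Path u u
    _∷_ : ∀ {u w v} → arc u w → Path w v → Path u v

  length : ∀ {u v} → Path u v → ℕ
  length []      = 0
  length (_ ∷ p) = suc (length p)

  vertices : ∀ {u v} → Path u v → List V
  vertices {u} []      = u ∷ []
  vertices {u} (_ ∷ p) = u ∷ vertices p

  arcs : ∀ {u v} → Path u v → List (V × V)
  arcs []                 = []
  arcs (_∷_ {u} {w} _ p) = (u , w) ∷ arcs p

  internal : ∀ {u v} → Path u v → List V
  internal []                      = []
  internal (_ ∷ [])                = []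
  internal (_∷_ {_} {w} _ (a ∷ p)) = w ∷ internal (a ∷ p)

  IsPath : ∀ {u v} → Path u v → Set
  IsPath p = Unique (vertices p)

  -- A total-colouring with (at most) k colours: colours of vertices and of
  -- arcs (the arc colour of (u,v) matters only when uv is an arc).
  record TotalColouring (k : ℕ) : Set where
    field
      vcol : V → Fin k
      acol : V → V → Fin k

  TotalRainbow : ∀ {k} → TotalColouring k → ∀ {u v} → Path u v → Set
  TotalRainbow c p =
    Unique (map (λ { (x , y) → TotalColouring.acol c x y }) (arcs p)
            ++ map (TotalColouring.vcol c) (internal p))

  Shortest : ∀ {u v} → Path u v → Set
  Shortest {u} {v} p = (q : Path u v) → length p ≤ length q

  TRConnected : ℕ → Set
  TRConnected k = Σ (TotalColouring k) λ c →
    (u v : V) → u ≢ v → Σ (Path u v) λ p → IsPath p × TotalRainbow c p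

  STRConnected : ℕ → Set
  STRConnected k = Σ (TotalColouring k) λ c →
    (u v : V) → u ≢ v → Σ (Path u v) λ p → IsPath p × Shortest p × TotalRainbow c p

IsMinimum : (ℕ → Set) → ℕ → Set
IsMinimum Q k = Q k × ((j : ℕ) → Q j → k ≤ j)

trc≡ : Digraph → ℕ → Set
trc≡ D k = IsMinimum (TRConnected D) k

strc≡ : Digraph → ℕ → Set
strc≡ D k = IsMinimum (STRConnected D) k

g : ℕ → ℕ
g 3  = 1
g 5  = 3
g 4  = 3
g 6  = 5
g 7  = 6
g 8  = 7
g 9  = 8
g 10 = 9
g 12 = 11
g n  = n

{-# OPTIONS --safe #-}
-- Lower bounds: a total-rainbow path of length L uses 2L − 1 colours, which settles paths, wheels,
-- multipartite graphs and, at the diameter, the cycles C₃, …, C₆, C₈, C₁₀, C₁₂.  On Cₙ with fewer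
-- than n colours a rainbow path has length at most n/2, so vertices at distance M < n/2 must be joined
-- the shorter way round.  Hence, listing vertices and clockwise arcs in cyclic order, any
-- two of the 2n entries of the same colour are at least 2M − 2 steps apart.  If 3(M − 1) > n, no colour
-- occurs three times and at least n colours are needed; n = 7 and n = 9 follow by weighing vertices
-- against arcs.
--
-- Upper bounds: colour the 2n entries of Cₙ by position modulo n, or by an explicit table for small n,
-- giving both arcs of an edge the same colour.

module Submission where

open import Defs
open import Data.Nat
open import Data.Nat.Properties
open import Data.Nat.DivMod
  using (_mod_; _%_; _/_; m%n<n; m<n⇒m%n≡m; [m+n]%n≡m%n; %-distribˡ-+; m≡m%n+[m/n]*n)
open import Data.Nat.ListAction using () renaming (sum to total)
open import Data.Nat.Tactic.RingSolver using (solve-∀)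
open import Data.Bool using (Bool; true; false; T; _∧_; _∨_)
open import Data.Bool.ListAction using (any)
open import Data.Bool.Properties using (T-∧; T-∨)
open import Data.Fin using (Fin; zero; suc; toℕ; fromℕ<; #_)
import Data.Fin as Fin
import Data.Fin.Properties as Fin
open import Data.Maybe using (just; nothing)
open import Data.Product as Product using (Σ; _×_; _,_; ∃; ∃-syntax; proj₁; proj₂)
open import Data.Sum as Sum using (_⊎_; inj₁; inj₂; [_,_]′)
open import Data.Empty using (⊥)
open import Data.Unit using (tt)
open import Data.List using (List; []; _∷_; _++_; map; applyUpTo; downFrom)
import Data.List as List
import Data.List.Properties as List
open import Data.List.Membership.Propositional using (_∈_)
open import Data.List.Membership.Propositional.Properties
  using (∈-map⁺; ∈-++⁺ˡ; ∈-++⁺ʳ; ∈-lookup; ∈-applyUpTo⁻)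
open import Data.List.Relation.Unary.Any using (here; there)
open import Data.List.Relation.Unary.All as All using (All; []; _∷_)
open import Data.List.Relation.Unary.AllPairs using ([]; _∷_)
open import Data.List.Relation.Unary.Unique.Propositional using (Unique)
import Data.List.Relation.Unary.Unique.Propositional.Properties as Unique
open import Data.Vec using (Vec; []; _∷_; lookup)
open import Algebra.Properties.CommutativeMonoid.Sum +-0-commutativeMonoid using (sum; ∑-distrib-+)
open import Function using (_∘_)
open import Function.Bundles using (Equivalence)
open import Relation.Nullary using (¬_; Dec; yes; no; ¬?; contradiction; _⊎-dec_; _×-dec_; _→-dec_)
open import Relation.Nullary.Decidable using (True; toWitness)
open import Relation.Binary.Definitions using (tri<; tri≈; tri>)
open import Relation.Binary.PropositionalEquality

-- Arithmetic contradictions and lists without repetition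

-- Closes linear arithmetic: several inequalities are added up to `m ≤ n`, while a ring identity
-- exhibits `m` as `n` plus a positive amount.
≰-by : ∀ {m n} k → m ≡ suc (k + n) → m ≰ n
≰-by {m} {n} k refl = <⇒≱ (s≤s (m≤n+m n k))

-- Along a rainbow path this turns equality of two colours into equality of the arcs or vertices
-- that carry them.
unique-map⇒injective : ∀ {A B : Set} {f : A → B} {xs x y} → Unique (map f xs) →
  x ∈ xs → y ∈ xs → f x ≡ f y → x ≡ y
unique-map⇒injective u (here refl) (here refl) _ = refl
unique-map⇒injective {f = f} (x∉ ∷ u) (here refl) (there y∈) eq =
  contradiction eq (All.lookup x∉ (∈-map⁺ f y∈))
unique-map⇒injective {f = f} (x∉ ∷ u) (there x∈) (here refl) eq =
  contradiction (sym eq) (All.lookup x∉ (∈-map⁺ f x∈))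
unique-map⇒injective (_ ∷ u) (there x∈) (there y∈) eq = unique-map⇒injective u x∈ y∈ eq

unique-++⇒disjoint : ∀ {A : Set} {xs ys : List A} {x y} → Unique (xs ++ ys) →
  x ∈ xs → y ∈ ys → x ≢ y
unique-++⇒disjoint {xs = _ ∷ xs} (x∉ ∷ u) (here refl) y∈ = All.lookup x∉ (∈-++⁺ʳ xs y∈)
unique-++⇒disjoint (_ ∷ u) (there x∈) y∈ = unique-++⇒disjoint u x∈ y∈

unique-++⁻ˡ : ∀ {A : Set} {xs ys : List A} → Unique (xs ++ ys) → Unique xs
unique-++⁻ˡ {xs = []} _ = []
unique-++⁻ˡ {xs = _ ∷ xs} (x∉ ∷ u) = All.tabulate (All.lookup x∉ ∘ ∈-++⁺ˡ) ∷ unique-++⁻ˡ u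

unique-++⁻ʳ : ∀ {A : Set} (xs : List A) {ys} → Unique (xs ++ ys) → Unique ys
unique-++⁻ʳ [] u = u
unique-++⁻ʳ (_ ∷ xs) (_ ∷ u) = unique-++⁻ʳ xs u

unique-lookup-injective : ∀ {A : Set} {xs : List A} → Unique xs →
  ∀ {i j} → List.lookup xs i ≡ List.lookup xs j → i ≡ j
unique-lookup-injective (_ ∷ _) {zero} {zero} _ = refl
unique-lookup-injective (x∉ ∷ _) {zero} {suc j} eq = contradiction eq (All.lookup x∉ (∈-lookup j))
unique-lookup-injective (x∉ ∷ _) {suc i} {zero} eq = contradiction (sym eq) (All.lookup x∉ (∈-lookup i))
unique-lookup-injective (_ ∷ u) {suc _} {suc _} eq = cong suc (unique-lookup-injective u eq)

-- Pigeonhole: `List.lookup` embeds the positions of the list into `Fin k`.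
unique⇒length≤ : ∀ {k} {xs : List (Fin k)} → Unique xs → List.length xs ≤ k
unique⇒length≤ u = Fin.injective⇒≤ (unique-lookup-injective u)

-- Rainbow paths in digraphs

module _ {D : Digraph} where
  open Digraph D
  open TotalColouring

  length-arcs : ∀ {u v} (p : Path D u v) → List.length (arcs D p) ≡ length D p
  length-arcs [] = refl
  length-arcs (_ ∷ p) = cong suc (length-arcs p)

  length-internal : ∀ {u v} (p : Path D u v) → List.length (internal D p) ≡ length D p ∸ 1
  length-internal [] = refl
  length-internal (_ ∷ []) = refl
  length-internal (_ ∷ (a ∷ p)) = cong suc (length-internal (a ∷ p))

  rainbow⇒length≤ : ∀ {k} (c : TotalColouring D k) {u v} (p : Path D u v) →
    TotalRainbow D c p → length D p + (length D p ∸ 1) ≤ k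
  rainbow⇒length≤ {k} c p r = subst (_≤ k) eq (unique⇒length≤ r)
    where
    eq = trans (List.length-++ (map _ (arcs D p)))
           (cong₂ _+_ (trans (List.length-map _ (arcs D p)) (length-arcs p))
                      (trans (List.length-map _ (internal D p)) (length-internal p)))

  distance⇒≤ : ∀ {k u v} d → u ≢ v → (∀ (p : Path D u v) → d ≤ length D p) →
    TRConnected D k → d + (d ∸ 1) ≤ k
  distance⇒≤ d u≢v far (c , conn) with conn _ _ u≢v
  ... | p , _ , r = ≤-trans (+-mono-≤ (far p) (∸-monoˡ-≤ 1 (far p))) (rainbow⇒length≤ c p r)

  STRConnected⇒TRConnected : ∀ {k} → STRConnected D k → TRConnected D k
  STRConnected⇒TRConnected (c , conn) = c , λ u v u≢v →
    let p , simple , _ , r = conn u v u≢v in p , simple , r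

  -- A strongly connecting colouring is also a connecting one, so one upper bound for the strong
  -- number and one lower bound for the plain number settle both.
  trc×strc : ∀ {k} → STRConnected D k → (∀ j → TRConnected D j → k ≤ j) →
    trc≡ D k × strc≡ D k
  trc×strc conn min =
    (STRConnected⇒TRConnected conn , min) , (conn , λ j → min j ∘ STRConnected⇒TRConnected)

  nonadjacent⇒2≤length : ∀ {u v} → u ≢ v → ¬ arc u v → (p : Path D u v) → 2 ≤ length D p
  nonadjacent⇒2≤length u≢v _ [] = contradiction refl u≢v
  nonadjacent⇒2≤length _ ¬a (a ∷ []) = contradiction a ¬a
  nonadjacent⇒2≤length _ _ (_ ∷ (_ ∷ p)) = s≤s (s≤s z≤n)

  distinct⇒1≤length : ∀ {u v} → u ≢ v → (p : Path D u v) → 1 ≤ length D p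
  distinct⇒1≤length u≢v [] = contradiction refl u≢v
  distinct⇒1≤length _ (_ ∷ p) = s≤s z≤n

  RainbowPath : ∀ {k} → TotalColouring D k → V → V → ℕ → Set
  RainbowPath c u v L = Σ (Path D u v) λ p → IsPath D p × TotalRainbow D c p × length D p ≡ L

  StrongPath : ∀ {k} → TotalColouring D k → V → V → Set
  StrongPath c u v = Σ (Path D u v) λ p → IsPath D p × Shortest D p × TotalRainbow D c p

  strong : ∀ {k} {c : TotalColouring D k} {u v L} → (∀ (p : Path D u v) → L ≤ length D p) →
    RainbowPath c u v L → StrongPath c u v
  strong far (p , simple , r , refl) = p , simple , far , r

  ∈-internal-here : ∀ {u w v} (a : arc u w) (p : Path D w v) → 0 < length D p → w ∈ internal D (a ∷ p)
  ∈-internal-here a (b ∷ p) _ = here refl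

  ∈-internal-there : ∀ {u w v x} (a : arc u w) (p : Path D w v) →
    x ∈ internal D p → x ∈ internal D (a ∷ p)
  ∈-internal-there a (b ∷ p) x∈ = there x∈

  walk : ∀ L (φ : ℕ → V) → (∀ t → t < L → arc (φ t) (φ (suc t))) → Path D (φ 0) (φ L)
  walk zero φ a = []
  walk (suc L) φ a = a 0 (s≤s z≤n) ∷ walk L (φ ∘ suc) (λ t → a (suc t) ∘ s≤s)

  length-walk : ∀ L φ a → length D (walk L φ a) ≡ L
  length-walk zero φ a = refl
  length-walk (suc L) φ a = cong suc (length-walk L (φ ∘ suc) _)

  vertices-walk : ∀ L φ a → vertices D (walk L φ a) ≡ applyUpTo φ (suc L)
  vertices-walk zero φ a = refl
  vertices-walk (suc L) φ a = cong (φ 0 ∷_) (vertices-walk L (φ ∘ suc) _)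

  arcs-walk : ∀ L φ a → arcs D (walk L φ a) ≡ applyUpTo (λ t → φ t , φ (suc t)) L
  arcs-walk zero φ a = refl
  arcs-walk (suc L) φ a = cong (_ ∷_) (arcs-walk L (φ ∘ suc) _)

  internal-walk : ∀ L φ a → internal D (walk L φ a) ≡ applyUpTo (φ ∘ suc) (L ∸ 1)
  internal-walk zero φ a = refl
  internal-walk (suc zero) φ a = refl
  internal-walk (suc (suc L)) φ a = cong (φ 1 ∷_) (internal-walk (suc L) (φ ∘ suc) (λ t → a (suc t) ∘ s≤s))

  -- The colours met along φ 0, φ 1, …, φ L are h 1, h 2, …, h (2L − 1).
  rainbow-walk : ∀ {k} (c : TotalColouring D k) L (φ : ℕ → V) (h : ℕ → Fin k) →
    (∀ t → t < L → arc (φ t) (φ (suc t))) →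
    (∀ {s t} → s < t → t ≤ L → φ s ≢ φ t) →
    (∀ {t} → t < L → vcol c (φ t) ≡ h (2 * t)) →
    (∀ {t} → t < L → acol c (φ t) (φ (suc t)) ≡ h (suc (2 * t))) →
    (∀ {p q} → 0 < p → p < q → q < 2 * L → h p ≢ h q) →
    RainbowPath c (φ 0) (φ L) L
  rainbow-walk c L φ h a φ-inj hv ha h-inj = walk L φ a ,
    subst Unique (sym (vertices-walk L φ a))
      (Unique.applyUpTo⁺₁ φ (suc L) λ { s<t (s≤s t≤L) → φ-inj s<t t≤L }) ,
    subst Unique (sym colours)
      (Unique.++⁺
        (Unique.applyUpTo⁺₁ _ L λ {i} {j} i<j j<L eq →
          h-inj (s≤s z≤n) (s≤s (*-monoʳ-< 2 i<j)) (odd< j<L)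
            (trans (sym (ha (<-trans i<j j<L))) (trans eq (ha j<L))))
        (Unique.applyUpTo⁺₁ _ (L ∸ 1) λ {i} {j} i<j j<L∸1 eq →
          h-inj (s≤s z≤n) (*-monoʳ-< 2 (s≤s i<j)) (*-monoʳ-< 2 (<pred⇒suc< j<L∸1))
            (trans (sym (hv (<pred⇒suc< (<-trans i<j j<L∸1)))) (trans eq (hv (<pred⇒suc< j<L∸1)))))
        λ { (x∈ , y∈) → disjoint (∈-applyUpTo⁻ _ x∈) (∈-applyUpTo⁻ _ y∈) }) ,
    length-walk L φ a
    where
    odd< : ∀ {j} → j < L → suc (2 * j) < 2 * L
    odd< {j} j<L = ≤-trans (≤-reflexive (sym (*-suc 2 j))) (*-monoʳ-≤ 2 j<L)

    <pred⇒suc< : ∀ {j} → j < L ∸ 1 → suc j < L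
    <pred⇒suc< lt = ≤-trans (s≤s lt) (suc-pred≤ L lt)
      where
      suc-pred≤ : ∀ L {j} → j < L ∸ 1 → suc (L ∸ 1) ≤ L
      suc-pred≤ (suc L) _ = ≤-refl

    disjoint : ∀ {x} →
      (∃ λ i → i < L × x ≡ acol c (φ i) (φ (suc i))) →
      (∃ λ j → j < L ∸ 1 × x ≡ vcol c (φ (suc j))) → ⊥
    -- The arc has position `2 * i + 1` and the internal vertex position `2 * j + 2`; the arc comes
    -- first exactly when `i ≤ j`.
    disjoint (i , i<L , refl) (j , j<L∸1 , eq) with <-cmp i j
      | trans (sym (ha i<L)) (trans eq (hv (<pred⇒suc< j<L∸1)))
    ... | tri< i<j _ _ | eq′ =
      h-inj (s≤s z≤n) (≤-trans (s≤s (s≤s (*-monoʳ-≤ 2 (<⇒≤ i<j)))) (≤-reflexive (sym (*-suc 2 j))))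
        (*-monoʳ-< 2 (<pred⇒suc< j<L∸1)) eq′
    ... | tri≈ _ refl _ | eq′ =
      h-inj (s≤s z≤n) (≤-reflexive (sym (*-suc 2 j))) (*-monoʳ-< 2 (<pred⇒suc< j<L∸1)) eq′
    ... | tri> _ _ j<i | eq′ =
      h-inj (s≤s z≤n) (s≤s (*-monoʳ-≤ 2 j<i)) (odd< i<L) (sym eq′)

    colours = cong₂ _++_
      (trans (cong (map _) (arcs-walk L φ a)) (List.map-applyUpTo _ _ L))
      (trans (cong (map _) (internal-walk L φ a)) (List.map-applyUpTo _ _ (L ∸ 1)))

module _ {D : Digraph} where
  open Digraph D
  open TotalColouring

  rainbow-arc : ∀ {k} (c : TotalColouring D k) {u v} → u ≢ v → arc u v → StrongPath c u v
  rainbow-arc c u≢v a = (a ∷ []) , ((u≢v ∷ []) ∷ ([] ∷ [])) , distinct⇒1≤length u≢v , ([] ∷ [])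

  rainbow-2path : ∀ {k} (c : TotalColouring D k) {u v w} →
    u ≢ v → u ≢ w → w ≢ v → ¬ arc u v → arc u w → arc w v →
    acol c u w ≢ acol c w v → acol c u w ≢ vcol c w → acol c w v ≢ vcol c w →
    StrongPath c u v
  rainbow-2path c u≢v u≢w w≢v ¬a a b e₁ e₂ e₃ =
    (a ∷ (b ∷ [])) ,
    ((u≢w ∷ (u≢v ∷ [])) ∷ ((w≢v ∷ []) ∷ ([] ∷ []))) ,
    nonadjacent⇒2≤length u≢v ¬a ,
    ((e₁ ∷ (e₂ ∷ [])) ∷ ((e₃ ∷ []) ∷ ([] ∷ [])))

-- Wheels

pathAdj? : ∀ n (i j : Fin n) → Dec (pathAdj n i j)
pathAdj? n i j = (suc (toℕ i) ≟ toℕ j) ⊎-dec (suc (toℕ j) ≟ toℕ i)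

cycleAdj? : ∀ n (i j : Fin n) → Dec (cycleAdj n i j)
cycleAdj? n i j = pathAdj? n i j
  ⊎-dec (((toℕ i ≟ 0) ×-dec (toℕ j ≟ n ∸ 1)) ⊎-dec ((toℕ j ≟ 0) ×-dec (toℕ i ≟ n ∸ 1)))

cycleAdj-sym : ∀ n i j → cycleAdj n i j → cycleAdj n j i
cycleAdj-sym n i j = Sum.map Sum.swap Sum.swap

-- Arcs are coloured by their tail, rim or hub, so a detour rim-hub-rim shows the colours 0, 2, 1.
wheel-colouring : ∀ n → TotalColouring (biorient (W n)) 3
wheel-colouring n = record
  { vcol = λ _ → suc (suc zero)
  ; acol = λ { nothing _ → suc zero ; (just _) _ → zero } }

wheel-connected : ∀ n → STRConnected (biorient (W n)) 3
wheel-connected n = wheel-colouring n , conn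
  where
  conn : ∀ u v → u ≢ v → StrongPath (wheel-colouring n) u v
  conn nothing nothing u≢v = contradiction refl u≢v
  conn nothing (just _) u≢v = rainbow-arc (wheel-colouring n) u≢v (inj₁ tt)
  conn (just _) nothing u≢v = rainbow-arc (wheel-colouring n) u≢v (inj₁ tt)
  conn (just i) (just j) u≢v with cycleAdj? n i j
  ... | yes a = rainbow-arc (wheel-colouring n) u≢v (inj₁ a)
  ... | no ¬a = rainbow-2path (wheel-colouring n) {w = nothing} u≢v (λ ()) (λ ())
                  [ ¬a , ¬a ∘ cycleAdj-sym n j i ]′ (inj₁ tt) (inj₁ tt) (λ ()) (λ ()) (λ ())

wheel-theorem : ∀ n → 4 ≤ n → trc≡ (biorient (W n)) 3 × strc≡ (biorient (W n)) 3
wheel-theorem n@(suc (suc (suc (suc m)))) (s≤s (s≤s (s≤s (s≤s _)))) =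
  -- Since `4 ≤ n`, the rim vertices 0 and 2 are not adjacent; distance 2 costs two arcs and one
  -- internal vertex.
  trc×strc (wheel-connected n) λ j →
    distance⇒≤ {u = just zero} {v = just (suc (suc zero))} 2 (λ ())
      (nonadjacent⇒2≤length (λ ()) [ zero≁2 , 2≁zero ]′)
  where
  zero≁2 : ¬ cycleAdj n zero (suc (suc zero))
  zero≁2 (inj₁ (inj₁ ()))
  zero≁2 (inj₁ (inj₂ ()))
  zero≁2 (inj₂ (inj₁ (_ , ())))
  zero≁2 (inj₂ (inj₂ (() , _)))
  2≁zero : ¬ cycleAdj n (suc (suc zero)) zero
  2≁zero = zero≁2 ∘ cycleAdj-sym n (suc (suc zero)) zero

-- Complete multipartite graphs

module _ {t} (ns : Fin (suc (suc t)) → ℕ) (ns≥1 : ∀ i → 1 ≤ ns i) where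
  private
    D = biorient (K (suc (suc t)) ns)

    orient : ∀ {m n} → Dec (m < n) → Fin 3
    orient (yes _) = zero
    orient (no _) = suc zero

    -- The colour of an arc tells whether the class index rises. A detour from a class through
    -- another and back rises once and does not rise once, so its arcs differ, and vertices have a
    -- third colour.
    colouring : TotalColouring D 3
    colouring = record
      { vcol = λ _ → suc (suc zero)
      ; acol = λ { (i , _) (j , _) → orient (toℕ i <? toℕ j) } }

    representative : ∀ i → Fin (ns i)
    representative i = fromℕ< (ns≥1 i)

  multipartite-connected : STRConnected D 3
  multipartite-connected = colouring , conn
    where
    conn : ∀ u v → u ≢ v → StrongPath colouring u v
    conn (i , a) (j , b) u≢v with i Fin.≟ j
    ... | no i≢j = rainbow-arc colouring u≢v (inj₁ i≢j)
    -- Two vertices of one class are joined through class 1 if they lie in class 0, and through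
    -- class 0 otherwise.
    conn (zero , a) (zero , b) u≢v | yes refl =
      rainbow-2path colouring {w = suc zero , representative _} u≢v (λ ()) (λ ())
        [ (λ x → x refl) , (λ x → x refl) ]′ (inj₁ λ ()) (inj₁ λ ()) (λ ()) (λ ()) (λ ())
    conn (suc i , a) (suc i , b) u≢v | yes refl =
      rainbow-2path colouring {w = zero , representative _} u≢v (λ ()) (λ ())
        [ (λ x → x refl) , (λ x → x refl) ]′ (inj₁ λ ()) (inj₁ λ ()) (λ ()) (λ ()) (λ ())

multipartite-theorem : ∀ t ns → 2 ≤ t → (∀ i → 1 ≤ ns i) → (∃[ i ] 2 ≤ ns i) →
  trc≡ (biorient (K t ns)) 3 × strc≡ (biorient (K t ns)) 3
multipartite-theorem (suc (suc t)) ns (s≤s (s≤s _)) ns≥1 (i , ns≥2) =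
  trc×strc (multipartite-connected ns ns≥1) λ j →
    distance⇒≤ {u = i , x} {v = i , y} 2 u≢v
      (nonadjacent⇒2≤length u≢v [ (λ p → p refl) , (λ p → p refl) ]′)
  where
  x = fromℕ< (≤-trans (s≤s z≤n) ns≥2)
  y = fromℕ< ns≥2
  u≢v : (i , x) ≢ (i , y)
  u≢v eq with trans (sym (Fin.toℕ-fromℕ< (≤-trans (s≤s z≤n) ns≥2)))
                (trans (cong (λ v → toℕ (proj₂ v)) eq) (Fin.toℕ-fromℕ< ns≥2))
  ... | ()

-- Residues and rainbow segments

∸-step : ∀ {t L} → t < L → L ∸ t ≡ suc (L ∸ suc t)
∸-step {zero} (s≤s _) = refl
∸-step {suc t} (s≤s t<L) = ∸-step t<L

toℕ-mod : ∀ {n s} .{{_ : NonZero n}} → s < n → toℕ (s mod n) ≡ s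
toℕ-mod {n} {s} s<n = trans (Fin.toℕ-fromℕ< (m%n<n s n)) (m<n⇒m%n≡m s<n)

module _ {n} .{{_ : NonZero n}} where
  mod-cong : ∀ {x y} → x % n ≡ y % n → x mod n ≡ y mod n
  mod-cong {x} {y} eq = Fin.toℕ-injective
    (trans (Fin.toℕ-fromℕ< (m%n<n x n)) (trans eq (sym (Fin.toℕ-fromℕ< (m%n<n y n)))))

  mod⁻¹-cong : ∀ {x y} → x mod n ≡ y mod n → x % n ≡ y % n
  mod⁻¹-cong {x} {y} eq =
    trans (sym (Fin.toℕ-fromℕ< (m%n<n x n))) (trans (cong toℕ eq) (Fin.toℕ-fromℕ< (m%n<n y n)))

  mod-toℕ : ∀ (i : Fin n) → toℕ i mod n ≡ i
  mod-toℕ i = Fin.toℕ-injective (toℕ-mod (Fin.toℕ<n i))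

  mod-+n : ∀ x → (x + n) mod n ≡ x mod n
  mod-+n x = mod-cong ([m+n]%n≡m%n x n)

  mod-+ : ∀ {x y} z → x mod n ≡ y mod n → (z + x) mod n ≡ (z + y) mod n
  mod-+ {x} {y} z eq = mod-cong (trans (%-distribˡ-+ z x n)
    (trans (cong (λ r → (z % n + r) % n) (mod⁻¹-cong eq)) (sym (%-distribˡ-+ z y n))))

  -- If the remainders agreed, either the quotient would not increase, giving `y ≤ x`, or it would
  -- increase, giving `x + n ≤ y`.
  mod-separated : ∀ {x y} → x < y → y < x + n → x mod n ≢ y mod n
  mod-separated {x} {y} x<y y<x+n eq = case (x / n <? y / n)
    where
    x≡ = m≡m%n+[m/n]*n x n
    y≡ = m≡m%n+[m/n]*n y n
    r≡ = mod⁻¹-cong eq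
    case : Dec (x / n < y / n) → ⊥
    case (no q≮) = <⇒≱ x<y (begin
      y                     ≡⟨ y≡ ⟩
      y % n + (y / n) * n   ≤⟨ +-mono-≤ (≤-reflexive (sym r≡)) (*-monoˡ-≤ n (≮⇒≥ q≮)) ⟩
      x % n + (x / n) * n   ≡⟨ x≡ ⟨
      x                     ∎)
      where open ≤-Reasoning
    case (yes q<) = <⇒≱ y<x+n (begin
      x + n                       ≡⟨ cong (_+ n) x≡ ⟩
      x % n + (x / n) * n + n     ≡⟨ +-assoc (x % n) _ n ⟩
      x % n + ((x / n) * n + n)   ≡⟨ cong (x % n +_) (+-comm _ n) ⟩
      x % n + suc (x / n) * n     ≤⟨ +-mono-≤ (≤-reflexive r≡) (*-monoˡ-≤ n q<) ⟩
      y % n + (y / n) * n         ≡⟨ y≡ ⟨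
      y                           ∎)
      where open ≤-Reasoning

module _ {n} .{{_ : NonZero n}} (adj : Fin n → Fin n → Set) where
  private
    D = biorient (record { V = Fin n ; adj = adj })
    open TotalColouring

  -- Half-steps: position 2s is the vertex s, position 2s + 1 the edge between s and s + 1.
  rainbow-segment : ∀ {k} (c : TotalColouring D k) (f : ℕ → Fin k) i L → L < n →
    (∀ s → i ≤ s → s < L + i → adj (s mod n) (suc s mod n)) →
    (∀ s → i ≤ s → s ≤ L + i → vcol c (s mod n) ≡ f (2 * s)) →
    (∀ s → i ≤ s → s < L + i → acol c (s mod n) (suc s mod n) ≡ f (suc (2 * s))) →
    (∀ s → i ≤ s → s < L + i → acol c (suc s mod n) (s mod n) ≡ f (suc (2 * s))) →
    (∀ p q → 2 * i < p → p < q → q < 2 * (L + i) → f p ≢ f q) →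
    RainbowPath c (i mod n) ((L + i) mod n) L × RainbowPath c ((L + i) mod n) (i mod n) L
  rainbow-segment c f i L L<n step hv ha ha′ f-inj =
    rainbow-walk c L φ (λ q → f (q + 2 * i))
      (λ t t<L → inj₁ (step (t + i) (m≤n+m i t) (+-monoˡ-< i t<L)))
      (λ s<t t≤L → mod-separated (+-monoˡ-< i s<t) (close (≤-<-trans t≤L L<n)))
      (λ {t} t<L → trans (hv (t + i) (m≤n+m i t) (+-monoˡ-≤ i (<⇒≤ t<L))) (cong f (*-distribˡ-+ 2 t i)))
      (λ {t} t<L → trans (ha (t + i) (m≤n+m i t) (+-monoˡ-< i t<L)) (cong (f ∘ suc) (*-distribˡ-+ 2 t i)))
      (λ {p} {q} 0<p p<q q<2L → f-inj (p + 2 * i) (q + 2 * i)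
        (+-monoˡ-< (2 * i) 0<p) (+-monoˡ-< (2 * i) p<q)
        (≤-trans (+-monoˡ-< (2 * i) q<2L) (≤-reflexive (sym (*-distribˡ-+ 2 L i))))) ,
    -- The reverse path reads the same positions downwards from `2 * (L + i)`. Its last vertex
    -- appears as `(L ∸ L + i) mod n`, hence the substitution.
    subst (λ v → RainbowPath c ((L + i) mod n) v L) (cong (λ r → (r + i) mod n) (n∸n≡0 L))
      (rainbow-walk c L ψ (λ q → f (2 * (L + i) ∸ q))
        (λ t t<L → inj₂ (subst (λ r → adj (ψ (suc t)) ((r + i) mod n)) (sym (∸-step t<L))
          (step (L ∸ suc t + i) (m≤n+m i _) (+-monoˡ-< i (∸-monoʳ-< z<s t<L)))))
        (λ {s} {t} s<t t≤L eq → mod-separated (+-monoˡ-< i (∸-monoʳ-< s<t t≤L))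
          (close (≤-<-trans (m∸n≤m L s) L<n)) (sym eq))
        (λ {t} t<L → trans (hv (L ∸ t + i) (m≤n+m i _) (+-monoˡ-≤ i (m∸n≤m L t)))
          (cong f (sym (double-∸ (<⇒≤ t<L)))))
        (λ {t} t<L → trans
          (subst (λ r → acol c ((r + i) mod n) (ψ (suc t)) ≡ f (suc (2 * (L ∸ suc t + i)))) (sym (∸-step t<L))
            (ha′ (L ∸ suc t + i) (m≤n+m i _) (+-monoˡ-< i (∸-monoʳ-< z<s t<L))))
          (cong f (double-∸′ t<L)))
        (λ {p} {q} 0<p p<q q<2L eq → f-inj (2 * (L + i) ∸ q) (2 * (L + i) ∸ p)
          (m+n≤o⇒m≤o∸n (suc (2 * i)) (≤-trans (+-monoʳ-< (2 * i) q<2L)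
            (≤-reflexive (trans (+-comm (2 * i) (2 * L)) (sym (*-distribˡ-+ 2 L i))))))
          (∸-monoʳ-< p<q (≤-trans (<⇒≤ q<2L) (*-monoʳ-≤ 2 (m≤m+n L i))))
          (∸-monoʳ-< 0<p (≤-trans (<⇒≤ (<-trans p<q q<2L)) (*-monoʳ-≤ 2 (m≤m+n L i))))
          (sym eq)))
    where
    φ ψ : ℕ → Fin n
    φ t = (t + i) mod n
    ψ t = (L ∸ t + i) mod n

    close : ∀ {a b} → a < n → a + i < b + i + n
    close {a} {b} a<n = ≤-trans (+-monoˡ-< i a<n)
      (≤-trans (≤-reflexive (+-comm n i)) (+-monoˡ-≤ n (m≤n+m i b)))

    double-∸ : ∀ {t} → t ≤ L → 2 * (L + i) ∸ 2 * t ≡ 2 * (L ∸ t + i)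
    double-∸ {t} t≤L = trans (sym (*-distribˡ-∸ 2 (L + i) t)) (cong (2 *_) (+-∸-comm i t≤L))

    double-∸′ : ∀ {t} → t < L → suc (2 * (L ∸ suc t + i)) ≡ 2 * (L + i) ∸ suc (2 * t)
    double-∸′ {t} t<L = trans
      (cong pred (sym (trans (double-∸ (<⇒≤ t<L))
        (trans (cong (λ r → 2 * (r + i)) (∸-step t<L)) (*-suc 2 (L ∸ suc t + i))))))
      (pred[m∸n]≡m∸[1+n] (2 * (L + i)) (2 * t))

-- Paths

pathAdj⇒≤ : ∀ {n i j} → pathAdj n i j → toℕ j ≤ suc (toℕ i)
pathAdj⇒≤ (inj₁ eq) = ≤-reflexive (sym eq)
pathAdj⇒≤ (inj₂ eq) = ≤-trans (n≤1+n _) (≤-trans (≤-reflexive eq) (n≤1+n _))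

path-arc⇒≤ : ∀ {n i j} → pathAdj n i j ⊎ pathAdj n j i → toℕ j ≤ suc (toℕ i)
path-arc⇒≤ = [ pathAdj⇒≤ , pathAdj⇒≤ ∘ Sum.swap ]′

-- Each arc raises the index by at most one. Together with `path-fall≤length` this bounds distances
-- from below by differences of indices.
path-rise≤length : ∀ {n u v} (p : Path (biorient (P n)) u v) →
  toℕ v ≤ length (biorient (P n)) p + toℕ u
path-rise≤length [] = ≤-refl
path-rise≤length {n} (a ∷ p) = ≤-trans (path-rise≤length p)
  (≤-trans (+-monoʳ-≤ (length (biorient (P n)) p) (path-arc⇒≤ a)) (≤-reflexive (+-suc _ _)))

path-fall≤length : ∀ {n u v} (p : Path (biorient (P n)) u v) →
  toℕ u ≤ length (biorient (P n)) p + toℕ v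
path-fall≤length [] = ≤-refl
path-fall≤length (a ∷ p) = ≤-trans (path-arc⇒≤ ([ inj₂ , inj₁ ]′ a)) (s≤s (path-fall≤length p))

module _ (m : ℕ) where
  private
    n k : ℕ
    n = suc (suc m)
    k = suc (2 * m)

    -- Vertex `i` sits at position `2 * i`, the edge after it at `2 * i + 1`. The positions strictly
    -- between the two ends of the whole path are 1 to `2 * m + 1`, which is `k` consecutive
    -- numbers, so reduction modulo `k` keeps them distinct.
    path-colouring : TotalColouring (biorient (P n)) k
    path-colouring = record
      { vcol = λ i → (2 * toℕ i) mod k
      ; acol = λ i j → suc (2 * (toℕ i ⊓ toℕ j)) mod k }

    segment : ∀ i L → L + i < n →
      RainbowPath path-colouring (i mod n) ((L + i) mod n) L ×
      RainbowPath path-colouring ((L + i) mod n) (i mod n) L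
    segment i L L+i<n = rainbow-segment (pathAdj n) path-colouring (_mod k) i L
      (≤-<-trans (m≤m+n L i) L+i<n)
      (λ s _ s< → inj₁ (trans (cong suc (toℕ-mod (<-trans (n<1+n s) (below s<)))) (sym (toℕ-mod (below s<)))))
      (λ s _ s≤ → cong (λ r → (2 * r) mod k) (toℕ-mod (≤-<-trans s≤ L+i<n)))
      (λ s _ s< → cong (λ r → suc (2 * r) mod k) (trans
        (cong₂ _⊓_ (toℕ-mod (<-trans (n<1+n s) (below s<))) (toℕ-mod (below s<)))
        (m≤n⇒m⊓n≡m (n≤1+n s))))
      (λ s _ s< → cong (λ r → suc (2 * r) mod k) (trans
        (cong₂ _⊓_ (toℕ-mod (below s<)) (toℕ-mod (<-trans (n<1+n s) (below s<))))
        (m≥n⇒m⊓n≡n (n≤1+n s))))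
      (λ p q 2i<p p<q q<2[L+i] → mod-separated p<q (span p q 2i<p q<2[L+i]))
      where
      below : ∀ {s} → s < L + i → suc s < n
      below s< = ≤-<-trans s< L+i<n

      span : ∀ p q → 2 * i < p → q < 2 * (L + i) → q < p + k
      span p q 2i<p q<2[L+i] = ≰⇒> λ p+k≤q → ≰-by 0 (identity L i p q m)
        (+-mono-≤ (+-mono-≤ (*-monoʳ-≤ 2 (≤-trans (m≤m+n L i) (s≤s⁻¹ L+i<n))) 2i<p)
          (+-mono-≤ p+k≤q q<2[L+i]))
        where
        identity : ∀ L i p q m → 2 * L + suc (2 * i) + (p + suc (2 * m) + suc q) ≡
                   suc (2 * suc m + p + (q + 2 * (L + i)))
        identity = solve-∀

  path-connected : STRConnected (biorient (P n)) k
  path-connected = path-colouring , conn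
    where
    up : ∀ {u v : Fin n} → toℕ u ≤ toℕ v → toℕ v ∸ toℕ u + toℕ u < n
    up {u} {v} u≤v = subst (_< n) (sym (m∸n+n≡m u≤v)) (Fin.toℕ<n v)

    end : ∀ {u v : Fin n} → toℕ u ≤ toℕ v → (toℕ v ∸ toℕ u + toℕ u) mod n ≡ v
    end {u} {v} u≤v = trans (cong (_mod n) (m∸n+n≡m u≤v)) (mod-toℕ v)

    conn : ∀ u v → u ≢ v → StrongPath path-colouring u v
    conn u v _ with ≤-total (toℕ u) (toℕ v)
    ... | inj₁ u≤v = strong
      (λ p → m≤n+o⇒m∸n≤o (toℕ v) (toℕ u) (subst (toℕ v ≤_) (+-comm _ (toℕ u)) (path-rise≤length p)))
      (subst₂ (λ x y → RainbowPath path-colouring x y (toℕ v ∸ toℕ u)) (mod-toℕ u) (end u≤v)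
        (proj₁ (segment (toℕ u) (toℕ v ∸ toℕ u) (up u≤v))))
    ... | inj₂ v≤u = strong
      (λ p → m≤n+o⇒m∸n≤o (toℕ u) (toℕ v) (subst (toℕ u ≤_) (+-comm _ (toℕ v)) (path-fall≤length p)))
      (subst₂ (λ x y → RainbowPath path-colouring x y (toℕ u ∸ toℕ v)) (end v≤u) (mod-toℕ v)
        (proj₂ (segment (toℕ v) (toℕ u ∸ toℕ v) (up v≤u))))

path-theorem : ∀ n → 2 ≤ n →
  trc≡ (biorient (P n)) (2 * n ∸ 3) × strc≡ (biorient (P n)) (2 * n ∸ 3)
path-theorem (suc (suc m)) (s≤s (s≤s _)) =
  subst (λ k → trc≡ D k × strc≡ D k) (sym 2n∸3≡1+2m)
    (trc×strc (path-connected m) λ j conn →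
      ≤-trans (≤-reflexive (1+2m≡ m))
        (distance⇒≤ {u = zero} {v = Fin.fromℕ (suc m)} (suc m) (λ ())
          (λ p → subst₂ _≤_ (Fin.toℕ-fromℕ (suc m)) (+-identityʳ _) (path-rise≤length p)) conn))
  where
  D = biorient (P (suc (suc m)))
  2n∸3≡1+2m : 2 * suc (suc m) ∸ 3 ≡ suc (2 * m)
  2n∸3≡1+2m = cong (_∸ 3) (2n≡ m)
    where
    2n≡ : ∀ m → 2 * suc (suc m) ≡ 3 + suc (2 * m)
    2n≡ = solve-∀
  1+2m≡ : ∀ m → suc (2 * m) ≡ suc m + m
  1+2m≡ = solve-∀

-- Walks and distances in cycles

module Cycle (n-1 : ℕ) where
  n : ℕ
  n = suc n-1

  D : Digraph
  D = biorient (C n)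

  mod-suc-toℕ : ∀ s → suc (toℕ (s mod n)) mod n ≡ suc s mod n
  mod-suc-toℕ s = mod-+ 1 (mod-toℕ (s mod n))

  -- Adding `n-1` undoes the successor modulo `n`.
  mod-suc-injective : ∀ {x y} → suc x mod n ≡ suc y mod n → x mod n ≡ y mod n
  mod-suc-injective {x} {y} eq = trans (shift x) (trans (mod-+ n-1 eq) (sym (shift y)))
    where
    shift : ∀ x → x mod n ≡ (n-1 + suc x) mod n
    shift x = trans (sym (mod-+n x)) (cong (_mod n) (trans (+-comm x n) (sym (+-suc n-1 x))))

  n-mod-n : n mod n ≡ 0 mod n
  n-mod-n = mod-+n 0

  Succ : Fin n → Fin n → Set
  Succ i j = j ≡ suc (toℕ i) mod n

  pathAdj⇒Succ : ∀ {i j} → suc (toℕ i) ≡ toℕ j → Succ i j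
  pathAdj⇒Succ {i} {j} eq = trans (sym (mod-toℕ j)) (cong (_mod n) (sym eq))

  wrap⇒Succ : ∀ {i j} → toℕ i ≡ 0 → toℕ j ≡ n-1 → Succ j i
  wrap⇒Succ {i} {j} i≡0 j≡n-1 = trans (sym (mod-toℕ i)) (trans (cong (_mod n) i≡0)
    (trans (sym n-mod-n) (cong (λ r → suc r mod n) (sym j≡n-1))))

  adj⇒Succ : ∀ {i j} → cycleAdj n i j → Succ i j ⊎ Succ j i
  adj⇒Succ (inj₁ (inj₁ eq)) = inj₁ (pathAdj⇒Succ eq)
  adj⇒Succ (inj₁ (inj₂ eq)) = inj₂ (pathAdj⇒Succ eq)
  adj⇒Succ (inj₂ (inj₁ (i≡0 , j≡n-1))) = inj₂ (wrap⇒Succ i≡0 j≡n-1)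
  adj⇒Succ (inj₂ (inj₂ (j≡0 , i≡n-1))) = inj₁ (wrap⇒Succ j≡0 i≡n-1)

  arc⇒Succ : ∀ {i j} → cycleAdj n i j ⊎ cycleAdj n j i → Succ i j ⊎ Succ j i
  arc⇒Succ (inj₁ a) = adj⇒Succ a
  arc⇒Succ (inj₂ a) with adj⇒Succ a
  ... | inj₁ s = inj₂ s
  ... | inj₂ s = inj₁ s

  adj-suc : ∀ s → cycleAdj n (s mod n) (suc s mod n)
  adj-suc s with suc (toℕ (s mod n)) <? n
  ... | yes r<n = inj₁ (inj₁ (trans (sym (toℕ-mod r<n)) (cong toℕ (mod-suc-toℕ s))))
  ... | no r≮n = inj₂ (inj₂ (
      cong toℕ (trans (sym (mod-suc-toℕ s)) (trans (cong (_mod n) r≡n) n-mod-n)) ,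
      suc-injective r≡n))
    where
    r≡n : suc (toℕ (s mod n)) ≡ n
    r≡n = ≤-antisym (Fin.toℕ<n (s mod n)) (≮⇒≥ r≮n)

  -- A walk in the cycle unrolls to a walk on the naturals, which starts far enough from 0 and
  -- passes over every edge between its two ends.
  record Unrolled {u v} (p : Path D u v) (s : ℕ) : Set where
    constructor unrolled
    field
      end        : ℕ
      end-mod    : end mod n ≡ v
      end≤       : end ≤ length D p + s
      start≤     : s ≤ length D p + end
      arcs⊇      : ∀ i → s ≤ i → i < end → (i mod n , suc i mod n) ∈ arcs D p
      internal⊇  : ∀ i → s < i → i < end → i mod n ∈ internal D p

  -- Follow the walk arc by arc, adding or subtracting one. The bound `length D p ≤ s` leaves room
  -- for every subtraction.
  unroll : ∀ {u v} (p : Path D u v) s → s mod n ≡ u → length D p ≤ s → Unrolled p s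
  unroll [] s s≡u _ = unrolled s s≡u ≤-refl ≤-refl
    (λ i s≤i i<s → contradiction s≤i (<⇒≱ i<s)) (λ i s<i i<s → contradiction s<i (<⇒≯ i<s))
  unroll (_∷_ {u} {w} a p) s refl len≤s with arc⇒Succ a
  ... | inj₁ w≡ = unrolled end end-mod
      (≤-trans end≤ (≤-reflexive (+-suc _ s)))
      (≤-trans (n≤1+n s) (≤-trans start≤ (n≤1+n _)))
      arcs⊇′ internal⊇′
    where
    w≡suc : suc s mod n ≡ w
    w≡suc = trans (sym (mod-suc-toℕ s)) (sym w≡)
    open Unrolled (unroll p (suc s) w≡suc (≤-trans (n≤1+n _) (≤-trans len≤s (n≤1+n s))))
    arcs⊇′ : ∀ i → s ≤ i → i < end → (i mod n , suc i mod n) ∈ arcs D (a ∷ p)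
    arcs⊇′ i s≤i i<e with m≤n⇒m<n∨m≡n s≤i
    ... | inj₁ s<i = there (arcs⊇ i s<i i<e)
    ... | inj₂ refl = here (cong (s mod n ,_) w≡suc)
    internal⊇′ : ∀ i → s < i → i < end → i mod n ∈ internal D (a ∷ p)
    internal⊇′ i s<i i<e with m≤n⇒m<n∨m≡n s<i
    ... | inj₁ s+1<i = ∈-internal-there a p (internal⊇ i s+1<i i<e)
    -- Here `i` is `suc s`, the head of the first arc; it is internal because `suc s < end` forces
    -- the rest of the walk to be nonempty.
    ... | inj₂ refl = subst (_∈ internal D (a ∷ p)) (sym w≡suc)
      (∈-internal-here a p (+-cancelʳ-< (suc s) 0 (length D p) (<-≤-trans i<e end≤)))
  -- After an anticlockwise first arc the rest of the walk starts lower, so it already covers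
  -- everything between `suc s` and `end`.
  unroll (_∷_ {u} {w} a p) (suc s) refl (s≤s len≤s) | inj₂ u≡ = unrolled end end-mod
      (≤-trans end≤ (≤-trans (n≤1+n _) (≤-trans (≤-reflexive (sym (+-suc _ s))) (n≤1+n _))))
      (s≤s start≤)
      (λ i s<i i<e → there (arcs⊇ i (<⇒≤ s<i) i<e))
      (λ i s+1<i i<e → ∈-internal-there a p (internal⊇ i (<-trans (n<1+n s) s+1<i) i<e))
    where
    open Unrolled (unroll p s (trans (mod-suc-injective u≡) (mod-toℕ w)) len≤s)

  mod-shift : ∀ L i → (L + (i + n)) mod n ≡ (L + i) mod n
  mod-shift L i = mod-+ L (mod-+n i)

  -- Going from s to s + L the other way round takes n − L steps.
  residue-unique : ∀ {ℓ L s e} → ℓ + L < n → e ≤ ℓ + s → s ≤ ℓ + e →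
    e mod n ≡ (L + s) mod n → e ≡ L + s
  residue-unique {ℓ} {L} {s} {e} ℓ+L<n e≤ s≤ eq with <-cmp e (L + s)
  ... | tri≈ _ e≡ _ = e≡
  ... | tri< e< _ _ = contradiction eq (mod-separated e< (begin-strict
    L + s          ≤⟨ +-monoʳ-≤ L s≤ ⟩
    L + (ℓ + e)    ≡⟨ +-assoc L ℓ e ⟨
    L + ℓ + e      ≡⟨ cong (_+ e) (+-comm L ℓ) ⟩
    ℓ + L + e      <⟨ +-monoˡ-< e ℓ+L<n ⟩
    n + e          ≡⟨ +-comm n e ⟩
    e + n          ∎))
    where open ≤-Reasoning
  ... | tri> _ _ >e = contradiction (sym eq) (mod-separated >e (begin-strict
    e              ≤⟨ e≤ ⟩
    ℓ + s          <⟨ +-monoˡ-< s (≤-<-trans (m≤m+n ℓ L) ℓ+L<n) ⟩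
    n + s          ≡⟨ +-comm n s ⟩
    s + n          ≤⟨ +-monoˡ-≤ n (m≤n+m s L) ⟩
    L + s + n      ∎))
    where open ≤-Reasoning

  shorter⇒sum<n : ∀ {ℓ L} → 2 * L ≤ n → ℓ < L → ℓ + L < n
  shorter⇒sum<n {ℓ} {L} 2L≤n ℓ<L =
    <-≤-trans (+-monoˡ-< L ℓ<L) (≤-trans (+-monoʳ-≤ L (≤-reflexive (sym (+-identityʳ L)))) 2L≤n)

  -- A path shorter than `L` has `ℓ + L < n`, so `residue-unique` puts its unrolled end exactly `L`
  -- above the start, out of reach in `ℓ` steps. The start `i + n` leaves room for the unrolling.
  distance-forward : ∀ i L → 2 * L ≤ n → (p : Path D (i mod n) ((L + i) mod n)) → L ≤ length D p
  distance-forward i L 2L≤n p = ≮⇒≥ λ ℓ<L →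
    let ℓ+L<n : length D p + L < n
        ℓ+L<n = shorter⇒sum<n 2L≤n ℓ<L
        open Unrolled (unroll p (i + n) (mod-+n i)
          (≤-trans (≤-trans (m≤m+n (length D p) L) (<⇒≤ ℓ+L<n)) (m≤n+m n i)))
    in <⇒≱ ℓ<L (+-cancelʳ-≤ (i + n) L (length D p) (subst (_≤ length D p + (i + n))
         (residue-unique ℓ+L<n end≤ start≤ (trans end-mod (sym (mod-shift L i)))) end≤))

  -- The argument of `distance-forward` with the two ends of the unrolled walk exchanged in
  -- `residue-unique`.
  distance-backward : ∀ i L → 2 * L ≤ n → (p : Path D ((L + i) mod n) (i mod n)) → L ≤ length D p
  distance-backward i L 2L≤n p = ≮⇒≥ λ ℓ<L →
    let open Unrolled (unroll p (L + (i + n)) (mod-shift L i) (≤-trans (<⇒≤ ℓ<L) (m≤m+n L _)))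
    in <⇒≱ ℓ<L (+-cancelʳ-≤ end L (length D p) (subst (_≤ length D p + end)
         (residue-unique (shorter⇒sum<n 2L≤n ℓ<L) start≤ end≤
           (trans (mod-shift L i) (mod-+ L (sym end-mod)))) start≤))

-- Colouring cycles by periodic sequences

-- The positions strictly between `2 * i` and `2 * (L + i)` are the edges and internal vertices of
-- the segment of `L` edges from `i`; the end vertices are left out.
Distinct : ∀ {A : Set} → (ℕ → A) → ℕ → ℕ → Set
Distinct f i L = ∀ p q → 2 * i < p → p < q → q < 2 * (L + i) → f p ≢ f q

Distinct-mono : ∀ {A : Set} {f : ℕ → A} {i L M} → L ≤ M → Distinct f i M → Distinct f i L
Distinct-mono {i = i} L≤M d p q 2i<p p<q q< =
  d p q 2i<p p<q (<-≤-trans q< (*-monoʳ-≤ 2 (+-monoˡ-≤ i L≤M)))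

module CycleColouring (n-1 : ℕ) (3≤n : 3 ≤ suc n-1) {k} (f : ℕ → Fin k)
    (periodic : ∀ p → f (p + 2 * suc n-1) ≡ f p) where
  open Cycle n-1

  periodic* : ∀ q p → f (p + q * (2 * n)) ≡ f p
  periodic* zero p = cong f (+-identityʳ p)
  periodic* (suc q) p = trans (cong f (identity p (2 * n) (q * (2 * n))))
    (trans (periodic _) (periodic* q p))
    where
    identity : ∀ a b c → a + (b + c) ≡ a + c + b
    identity = solve-∀

  f-mod : ∀ b s → f (b + 2 * toℕ (s mod n)) ≡ f (b + 2 * s)
  f-mod b s = sym (trans (cong (λ r → f (b + 2 * r)) s≡)
    (trans (cong f (identity b (toℕ (s mod n)) (s / n) n)) (periodic* (s / n) _)))
    where
    s≡ : s ≡ toℕ (s mod n) + s / n * n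
    s≡ = trans (m≡m%n+[m/n]*n s n) (cong (_+ s / n * n) (sym (Fin.toℕ-fromℕ< (m%n<n s n))))
    identity : ∀ b r q n → b + 2 * (r + q * n) ≡ b + 2 * r + q * (2 * n)
    identity = solve-∀

  -- An edge is named by its anticlockwise end, so both of its arcs read the same position of `f`.
  base : ∀ i j → Dec (j ≡ suc (toℕ i) mod n) → Fin n
  base i j (yes _) = i
  base i j (no _) = j

  colouring : TotalColouring D k
  colouring = record
    { vcol = λ i → f (2 * toℕ i)
    ; acol = λ i j → f (suc (2 * toℕ (base i j (j Fin.≟ (suc (toℕ i) mod n))))) }

  base-forward : ∀ s → base (s mod n) (suc s mod n) (suc s mod n Fin.≟ (suc (toℕ (s mod n)) mod n)) ≡ s mod n
  base-forward s with suc s mod n Fin.≟ (suc (toℕ (s mod n)) mod n)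
  ... | yes _ = refl
  ... | no ≢ = contradiction (sym (mod-suc-toℕ s)) ≢

  -- A backward arc would be mistaken for a forward one only if `s` and `s + 2` agreed modulo `n`,
  -- which `3 ≤ n` excludes.
  base-backward : ∀ s → base (suc s mod n) (s mod n) (s mod n Fin.≟ (suc (toℕ (suc s mod n)) mod n)) ≡ s mod n
  base-backward s with s mod n Fin.≟ (suc (toℕ (suc s mod n)) mod n)
  ... | no _ = refl
  ... | yes eq = contradiction (trans eq (mod-suc-toℕ (suc s)))
    (mod-separated (m<n+m s {2} z<s) (≤-trans (≤-reflexive (+-comm 3 s)) (+-monoʳ-≤ s 3≤n)))

  StrongPair : Fin n → Fin n → Set
  StrongPair u v = StrongPath colouring u v × StrongPath colouring v u

  segment : ∀ i L → 2 * L ≤ n → Distinct f i L → StrongPair (i mod n) ((L + i) mod n)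
  segment i L 2L≤n distinct = strong (distance-forward i L 2L≤n) (proj₁ paths) ,
                              strong (distance-backward i L 2L≤n) (proj₂ paths)
    where
    L<n : L < n
    L<n = *-cancelˡ-< 2 L n (≤-<-trans 2L≤n (≤-trans (s≤s (m≤m+n n (n-1 + 0))) (≤-reflexive (sym (+-suc n _)))))
    paths = rainbow-segment (cycleAdj n) colouring f i L L<n
      (λ s _ _ → adj-suc s)
      (λ s _ _ → f-mod 0 s)
      (λ s _ _ → trans (cong (λ r → f (suc (2 * toℕ r))) (base-forward s)) (f-mod 1 s))
      (λ s _ _ → trans (cong (λ r → f (suc (2 * toℕ r))) (base-backward s)) (f-mod 1 s))
      distinct

  -- Antipodal vertices have two shortest connections, and it suffices that one of the two
  -- half-circles is rainbow; at smaller distance there is no choice.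
  Short Antipodal : Set
  Short = ∀ i L → i < n → 2 * L < n → Distinct f i L
  Antipodal = ∀ i L → i < n → 2 * L ≡ n → Distinct f i L ⊎ Distinct f (L + i) L

  cycle-connected : Short → Antipodal → STRConnected D k
  cycle-connected short antipodal = colouring , λ u v _ → conn u v (≤-total (toℕ u) (toℕ v))
    where
    around : ∀ i d L → L + d ≡ n → (L + (d + i)) mod n ≡ i mod n
    around i d L L+d≡n = trans
      (cong (_mod n) (trans (sym (+-assoc L d i)) (trans (cong (_+ i) L+d≡n) (+-comm n i))))
      (mod-+n i)

    complement : ∀ i d L → 2 * L ≤ n → L + d ≡ n → Distinct f (d + i) L →
      StrongPair (i mod n) ((d + i) mod n)
    complement i d L 2L≤n L+d≡n distinct = Product.swap
      (subst (StrongPair ((d + i) mod n)) (around i d L L+d≡n) (segment (d + i) L 2L≤n distinct))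

    pair : ∀ i d → d + i < n → StrongPair (i mod n) ((d + i) mod n)
    -- If the clockwise distance `d` exceeds `n / 2`, the shortest way leads from `d + i` past 0 to
    -- `i + n`, a segment of `n ∸ d` edges.
    pair i d d+i<n with <-cmp (2 * d) n
    ... | tri< 2d<n _ _ = segment i d (<⇒≤ 2d<n) (short i d (≤-<-trans (m≤n+m i d) d+i<n) 2d<n)
    ... | tri≈ _ 2d≡n _ = [ segment i d (≤-reflexive 2d≡n)
        , complement i d d (≤-reflexive 2d≡n) (trans (cong (d +_) (sym (+-identityʳ d))) 2d≡n) ]′
        (antipodal i d (≤-<-trans (m≤n+m i d) d+i<n) 2d≡n)
    ... | tri> _ _ n<2d = complement i d L (<⇒≤ 2L<n) L+d≡n (short (d + i) L d+i<n 2L<n)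
      where
      L : ℕ
      L = n ∸ d
      L+d≡n : L + d ≡ n
      L+d≡n = m∸n+n≡m (<⇒≤ (≤-<-trans (m≤m+n d i) d+i<n))
      2L<n : 2 * L < n
      2L<n = ≰⇒> λ n≤2L → <-irrefl (identity L d)
        (+-mono-≤-< (subst (_≤ 2 * L) (sym L+d≡n) n≤2L) (subst (_< 2 * d) (sym L+d≡n) n<2d))
        where
        identity : ∀ L d → L + d + (L + d) ≡ 2 * L + 2 * d
        identity = solve-∀

    pair′ : ∀ u v → toℕ u ≤ toℕ v → StrongPair u v
    pair′ u v u≤v = subst₂ StrongPair (mod-toℕ u) (trans (cong (_mod n) d+u≡v) (mod-toℕ v))
      (pair (toℕ u) (toℕ v ∸ toℕ u) (subst (_< n) (sym d+u≡v) (Fin.toℕ<n v)))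
      where
      d+u≡v : toℕ v ∸ toℕ u + toℕ u ≡ toℕ v
      d+u≡v = m∸n+n≡m u≤v

    conn : ∀ u v → toℕ u ≤ toℕ v ⊎ toℕ v ≤ toℕ u → StrongPath colouring u v
    conn u v (inj₁ u≤v) = proj₁ (pair′ u v u≤v)
    conn u v (inj₂ v≤u) = proj₂ (pair′ v u v≤u)

-- A segment with `2 * L ≤ n` has `2 * L − 1 < n` consecutive inner positions, whose residues modulo
-- `n` differ.
cycle-connected-n : ∀ n-1 → 3 ≤ suc n-1 → STRConnected (biorient (C (suc n-1))) (suc n-1)
cycle-connected-n n-1 3≤n = cycle-connected
  (λ i L _ 2L<n → distinct i L (<⇒≤ 2L<n)) (λ i L _ 2L≡n → inj₁ (distinct i L (≤-reflexive 2L≡n)))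
  where
  n : ℕ
  n = suc n-1
  open CycleColouring n-1 3≤n (_mod n)
    (λ p → trans (cong (_mod n) (trans (cong (λ r → p + (n + r)) (+-identityʳ n)) (sym (+-assoc p n n))))
      (trans (mod-+n (p + n)) (mod-+n p)))
  distinct : ∀ i L → 2 * L ≤ n → Distinct (_mod n) i L
  distinct i L 2L≤n p q 2i<p p<q q< = mod-separated p<q (<-≤-trans q< (begin
    2 * (L + i)      ≡⟨ *-distribˡ-+ 2 L i ⟩
    2 * L + 2 * i    ≤⟨ +-mono-≤ 2L≤n (<⇒≤ 2i<p) ⟩
    n + p            ≡⟨ +-comm n p ⟩
    p + n            ∎))
    where open ≤-Reasoning

-- Small cycles by checked tables

-- `Distinct` counted from position `2 * i + 1`, with nested bounds in the shape that `allUpTo?`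
-- decides.
DistinctShift : ∀ {A : Set} → (ℕ → A) → ℕ → ℕ → Set
DistinctShift f i L =
  ∀ {q} → q < 2 * L ∸ 1 → ∀ {p} → p < q → f (suc p + 2 * i) ≢ f (suc q + 2 * i)

DistinctShift? : ∀ {k} (f : ℕ → Fin k) i L → Dec (DistinctShift f i L)
DistinctShift? f i L = allUpTo?
  (λ q → allUpTo? (λ p → ¬? (f (suc p + 2 * i) Fin.≟ f (suc q + 2 * i))) q) (2 * L ∸ 1)

shift⇒Distinct : ∀ {A : Set} {f : ℕ → A} i L →
  DistinctShift f i L → Distinct f i L
shift⇒Distinct {f = f} i L d p q 2i<p p<q q< eq with m≤n⇒∃[o]m+o≡n 2i<p | m≤n⇒∃[o]m+o≡n (<-trans 2i<p p<q)
... | p′ , refl | q′ , refl = d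
    (m+n≤o⇒m≤o∸n (suc q′) (subst (_≤ 2 * L) (+-comm 1 (suc q′)) (+-cancelʳ-≤ (2 * i) _ _
      (≤-trans (≤-reflexive (cong (λ r → 2 + r) (+-comm q′ (2 * i))))
        (≤-trans q< (≤-reflexive (*-distribˡ-+ 2 L i)))))))
    (+-cancelˡ-< (suc (2 * i)) p′ q′ p<q)
    (subst₂ (λ x y → f (suc x) ≡ f (suc y)) (+-comm (2 * i) p′) (+-comm (2 * i) q′) eq)

module _ (n-1 : ℕ) (3≤n : 3 ≤ suc n-1) {k} (table : Vec (Fin k) (2 * suc n-1)) where
  private
    n h : ℕ
    n = suc n-1
    h = ⌊ n /2⌋

    f : ℕ → Fin k
    f p = lookup table (p mod (2 * n))

    open CycleColouring n-1 3≤n f (λ p → cong (lookup table) (mod-+n p))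

    halve : ∀ L → ⌊ 2 * L /2⌋ ≡ L
    halve L = trans (cong (λ r → ⌊ L + r /2⌋) (+-identityʳ L)) (sym (n≡⌊n+n/2⌋ L))

    Short? : Dec (∀ {i} → i < n → DistinctShift f i ⌊ n-1 /2⌋)
    Short? = allUpTo? (λ i → DistinctShift? f i ⌊ n-1 /2⌋) n

    Antipodal? : Dec (2 * h ≡ n → ∀ {i} → i < n → DistinctShift f i h ⊎ DistinctShift f (h + i) h)
    Antipodal? = (2 * h ≟ n) →-dec
      allUpTo? (λ i → DistinctShift? f i h ⊎-dec DistinctShift? f (h + i) h) n

  -- By `Distinct-mono` only the greatest length below `n / 2` is tested, besides the antipodal one
  -- for even `n`. The `True` arguments make type checking run the tests on the table.
  cycle-connected-by-table : True Short? → True Antipodal? → STRConnected (biorient (C n)) k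
  cycle-connected-by-table short antipodal = cycle-connected
    (λ i L i<n 2L<n → Distinct-mono {i = i}
      (subst (_≤ ⌊ n-1 /2⌋) (halve L) (⌊n/2⌋-mono (s≤s⁻¹ 2L<n)))
      (shift⇒Distinct i ⌊ n-1 /2⌋ (toWitness short i<n)))
    (λ i L i<n 2L≡n → subst (λ L → Distinct f i L ⊎ Distinct f (L + i) L)
      (trans (cong ⌊_/2⌋ (sym 2L≡n)) (halve L))
      (Sum.map (shift⇒Distinct i h) (shift⇒Distinct (h + i) h)
        (toWitness antipodal (trans (cong (2 *_) (trans (cong ⌊_/2⌋ (sym 2L≡n)) (halve L))) 2L≡n) i<n)))

C3-connected : STRConnected (biorient (C 3)) 1
C3-connected = cycle-connected-by-table 2 (s≤s (s≤s (s≤s z≤n)))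
  -- In this and the following tables, vertices and edges alternate, starting with vertex 0 and the
  -- edge from 0 to 1.
  (# 0 ∷ # 0 ∷ # 0 ∷ # 0 ∷ # 0 ∷ # 0 ∷ []) _ _

C4-connected : STRConnected (biorient (C 4)) 3
C4-connected = cycle-connected-by-table 3 (s≤s (s≤s (s≤s z≤n)))
  (# 0 ∷ # 0 ∷ # 1 ∷ # 2 ∷ # 0 ∷ # 1 ∷ # 0 ∷ # 0 ∷ []) _ _

C5-connected : STRConnected (biorient (C 5)) 3
C5-connected = cycle-connected-by-table 4 (s≤s (s≤s (s≤s z≤n)))
  (# 0 ∷ # 1 ∷ # 0 ∷ # 2 ∷ # 0 ∷ # 1 ∷ # 2 ∷ # 0 ∷ # 1 ∷ # 2 ∷ []) _ _

C6-connected : STRConnected (biorient (C 6)) 5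
C6-connected = cycle-connected-by-table 5 (s≤s (s≤s (s≤s z≤n)))
  (# 0 ∷ # 1 ∷ # 0 ∷ # 2 ∷ # 3 ∷ # 4 ∷ # 0 ∷ # 1 ∷ # 2 ∷ # 3 ∷ # 0 ∷ # 2 ∷ []) _ _

C7-connected : STRConnected (biorient (C 7)) 6
C7-connected = cycle-connected-by-table 6 (s≤s (s≤s (s≤s z≤n)))
  (# 0 ∷ # 1 ∷ # 2 ∷ # 3 ∷ # 0 ∷ # 4 ∷ # 1 ∷ # 2 ∷ # 0 ∷ # 5 ∷ # 1 ∷ # 3 ∷ # 2 ∷ # 4 ∷ []) _ _

C8-connected : STRConnected (biorient (C 8)) 7
C8-connected = cycle-connected-by-table 7 (s≤s (s≤s (s≤s z≤n)))
  (# 0 ∷ # 1 ∷ # 2 ∷ # 3 ∷ # 0 ∷ # 5 ∷ # 6 ∷ # 4 ∷ # 1 ∷ # 2 ∷ # 0 ∷ # 3 ∷ # 5 ∷ # 6 ∷ # 2 ∷ # 4 ∷ []) _ _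

C9-connected : STRConnected (biorient (C 9)) 8
C9-connected = cycle-connected-by-table 8 (s≤s (s≤s (s≤s z≤n)))
  (# 0 ∷ # 1 ∷ # 2 ∷ # 3 ∷ # 4 ∷ # 5 ∷ # 0 ∷ # 6 ∷ # 2 ∷ # 1 ∷ # 4 ∷ # 3 ∷ # 0 ∷ # 5 ∷ # 2 ∷ # 7 ∷ # 4 ∷ # 6 ∷ []) _ _

C10-connected : STRConnected (biorient (C 10)) 9
C10-connected = cycle-connected-by-table 9 (s≤s (s≤s (s≤s z≤n)))
  (# 0 ∷ # 1 ∷ # 2 ∷ # 3 ∷ # 4 ∷ # 5 ∷ # 0 ∷ # 7 ∷ # 8 ∷ # 6 ∷ # 1 ∷ # 2 ∷ # 4 ∷ # 3 ∷ # 0 ∷ # 5 ∷ # 7 ∷ # 8 ∷ # 4 ∷ # 6 ∷ []) _ _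

C12-connected : STRConnected (biorient (C 12)) 11
C12-connected = cycle-connected-by-table 11 (s≤s (s≤s (s≤s z≤n)))
  (# 0 ∷ # 1 ∷ # 2 ∷ # 3 ∷ # 4 ∷ # 5 ∷ # 6 ∷ # 7 ∷ # 0 ∷ # 9 ∷ # 10 ∷ # 8 ∷ # 1 ∷ # 2 ∷ # 6 ∷ # 3 ∷ # 0 ∷ # 4 ∷ # 5 ∷ # 7 ∷ # 9 ∷ # 10 ∷ # 6 ∷ # 8 ∷ []) _ _

-- Weighing colour classes

-- Structural recursion on both indices, instead of a test of equality, lets `sum-indicator` reduce
-- by induction.
indicator : ∀ {k} → Fin k → Fin k → ℕ → ℕ
indicator zero zero m = m
indicator zero (suc _) m = 0
indicator (suc _) zero m = 0
indicator (suc i) (suc j) m = indicator i j m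

indicator-≡ : ∀ {k} (i : Fin k) m → indicator i i m ≡ m
indicator-≡ zero m = refl
indicator-≡ (suc i) m = indicator-≡ i m

indicator-≢ : ∀ {k} {i j : Fin k} m → i ≢ j → indicator i j m ≡ 0
indicator-≢ {i = zero} {zero} m i≢j = contradiction refl i≢j
indicator-≢ {i = zero} {suc j} m _ = refl
indicator-≢ {i = suc i} {zero} m _ = refl
indicator-≢ {i = suc i} {suc j} m i≢j = indicator-≢ m (i≢j ∘ cong suc)

sum-0 : ∀ k → sum {k} (λ _ → 0) ≡ 0
sum-0 zero = refl
sum-0 (suc k) = sum-0 k

sum-indicator : ∀ {k} (i : Fin k) m → sum (λ j → indicator i j m) ≡ m
sum-indicator {suc k} zero m = trans (cong (m +_) (sum-0 k)) (+-identityʳ m)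
sum-indicator (suc i) m = sum-indicator i m

sum-≤ : ∀ {k} (t : Fin k → ℕ) b → (∀ i → t i ≤ b) → sum t ≤ k * b
sum-≤ {zero} t b t≤b = z≤n
sum-≤ {suc k} t b t≤b = +-mono-≤ (t≤b zero) (sum-≤ (t ∘ suc) b (t≤b ∘ suc))

module Load {k} (f : ℕ → Fin k) (w : ℕ → ℕ) where
  load : Fin k → List ℕ → ℕ
  load c [] = 0
  load c (x ∷ xs) = indicator (f x) c (w x) + load c xs

  load-∈ : ∀ {c x} xs → f x ≡ c → load c (x ∷ xs) ≡ w x + load c xs
  load-∈ {x = x} xs refl = cong (_+ load (f x) xs) (indicator-≡ (f x) (w x))

  load-∉ : ∀ {c x} xs → f x ≢ c → load c (x ∷ xs) ≡ load c xs
  load-∉ {c} {x} xs fx≢c = cong (_+ load c xs) (indicator-≢ (w x) fx≢c)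

  sum-load : ∀ xs → sum (λ c → load c xs) ≡ total (map w xs)
  sum-load [] = sum-0 k
  sum-load (x ∷ xs) = trans (∑-distrib-+ (λ c → indicator (f x) c (w x)) (λ c → load c xs))
    (cong₂ _+_ (sum-indicator (f x) (w x)) (sum-load xs))

  -- Double counting: each element of `xs` puts its weight on exactly one of the `k` colours.
  load≤⇒sum≤ : ∀ xs b → (∀ c → load c xs ≤ b) → total (map w xs) ≤ k * b
  load≤⇒sum≤ xs b load≤b = subst (_≤ k * b) (sum-load xs) (sum-≤ (λ c → load c xs) b load≤b)

module Search (w : ℕ → ℕ) (conflict : ℕ → ℕ → Bool) where
  -- Every conflict-free set that contains chosen and grows by elements of xs adds weight at most b.
  light : List ℕ → List ℕ → ℕ → Bool
  light [] chosen b = true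
  light (x ∷ xs) chosen b = light xs chosen b ∧
    (any (conflict x) chosen ∨ ((w x ≤ᵇ b) ∧ light xs (x ∷ chosen) (b ∸ w x)))

  module _ {k} (f : ℕ → Fin k) (sound : ∀ x y → T (conflict x y) → f x ≢ f y) where
    open Load f w

    conflict⇒≢ : ∀ {c} x chosen → T (any (conflict x) chosen) → All (λ y → f y ≡ c) chosen → f x ≢ c
    conflict⇒≢ x (y ∷ ys) t (refl ∷ ys≡c) with Equivalence.to (T-∨ {conflict x y}) t
    ... | inj₁ xy = sound x y xy
    ... | inj₂ t′ = conflict⇒≢ x ys t′ ys≡c

    -- Elements of colour `c` never conflict with each other, so the branch of the search that takes
    -- exactly these elements bounds their weight.
    light⇒load≤ : ∀ {c} xs chosen b → T (light xs chosen b) → All (λ y → f y ≡ c) chosen → load c xs ≤ b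
    light⇒load≤ [] chosen b _ _ = z≤n
    light⇒load≤ {c} (x ∷ xs) chosen b t chosen≡c
      with f x Fin.≟ c | Equivalence.to (T-∧ {light xs chosen b}) t
    ... | no x∉c | t₁ , _ = ≤-trans (≤-reflexive (load-∉ xs x∉c)) (light⇒load≤ xs chosen b t₁ chosen≡c)
    ... | yes x∈c | _ , t₂ with Equivalence.to (T-∨ {any (conflict x) chosen}) t₂
    ... | inj₁ t₃ = contradiction x∈c (conflict⇒≢ x chosen t₃ chosen≡c)
    ... | inj₂ t₃ with Equivalence.to (T-∧ {w x ≤ᵇ b}) t₃
    ... | wx≤b , t₄ = begin
      load c (x ∷ xs)     ≡⟨ load-∈ xs x∈c ⟩
      w x + load c xs     ≤⟨ +-monoʳ-≤ (w x) (light⇒load≤ xs (x ∷ chosen) (b ∸ w x) t₄ (x∈c ∷ chosen≡c)) ⟩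
      w x + (b ∸ w x)     ≡⟨ m+[n∸m]≡n (≤ᵇ⇒≤ (w x) b wx≤b) ⟩
      b                   ∎
      where open ≤-Reasoning

module _ {k} (f : ℕ → Fin k) N (no-triple : ∀ {x y z} → x < y → y < z → z < N → f x ≡ f y → f y ≢ f z) where
  open Load f (λ _ → 1)

  private
    -- The list is scanned from large to small; `load-2`, `load-1` and `load-0` bound what is left
    -- below `m` once two, one or no elements of colour `c` have been met.
    load-2 : ∀ {c} m y z → m ≤ y → y < z → z < N → f y ≡ c → f z ≡ c → load c (downFrom m) ≤ 0
    load-2 zero y z _ _ _ _ _ = z≤n
    load-2 {c} (suc m) y z m<y y<z z<N y∈c z∈c with f m Fin.≟ c
    ... | yes m∈c = contradiction (trans y∈c (sym z∈c)) (no-triple m<y y<z z<N (trans m∈c (sym y∈c)))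
    ... | no m∉c = ≤-trans (≤-reflexive (load-∉ (downFrom m) m∉c)) (load-2 m y z (<⇒≤ m<y) y<z z<N y∈c z∈c)

    load-1 : ∀ {c} m z → m ≤ z → z < N → f z ≡ c → load c (downFrom m) ≤ 1
    load-1 zero z _ _ _ = z≤n
    load-1 {c} (suc m) z m<z z<N z∈c with f m Fin.≟ c
    ... | yes m∈c = ≤-trans (≤-reflexive (load-∈ (downFrom m) m∈c)) (s≤s (load-2 m m z ≤-refl m<z z<N m∈c z∈c))
    ... | no m∉c = ≤-trans (≤-reflexive (load-∉ (downFrom m) m∉c)) (load-1 m z (<⇒≤ m<z) z<N z∈c)

    load-0 : ∀ {c} m → m ≤ N → load c (downFrom m) ≤ 2
    load-0 zero _ = z≤n
    load-0 {c} (suc m) m<N with f m Fin.≟ c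
    ... | yes m∈c = ≤-trans (≤-reflexive (load-∈ (downFrom m) m∈c)) (s≤s (load-1 m m ≤-refl m<N m∈c))
    ... | no m∉c = ≤-trans (≤-reflexive (load-∉ (downFrom m) m∉c)) (load-0 m (<⇒≤ m<N))

    sum-ones : ∀ m → total (map (λ _ → 1) (downFrom m)) ≡ m
    sum-ones zero = refl
    sum-ones (suc m) = cong suc (sum-ones m)

  no-triple⇒≤ : N ≤ k * 2
  no-triple⇒≤ = subst (_≤ k * 2) (sum-ones N) (load≤⇒sum≤ (downFrom N) 2 λ c → load-0 N ≤-refl)

-- Colour sequences of cycles with fewer than `n` colours

even⊎odd : ∀ p → (∃ λ i → p ≡ 2 * i) ⊎ (∃ λ i → p ≡ suc (2 * i))
even⊎odd zero = inj₁ (0 , refl)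
even⊎odd (suc p) with even⊎odd p
... | inj₁ (i , refl) = inj₂ (i , refl)
... | inj₂ (i , refl) = inj₁ (suc i , sym (*-suc 2 i))

module CycleLower (n-1 : ℕ) {k} (k<n : k < suc n-1) (conn : TRConnected (biorient (C (suc n-1))) k)
    (M : ℕ) (1≤M : 1 ≤ M) (2M<n : 2 * M < suc n-1) where
  open Cycle n-1
  open TotalColouring (proj₁ conn)

  -- Vertices and clockwise arcs share one sequence, so that the gap between equal colours is
  -- measured in half-steps.
  hueFrom : ℕ → ℕ → Fin k
  hueFrom i zero = vcol (i mod n)
  hueFrom i (suc zero) = acol (i mod n) (suc i mod n)
  hueFrom i (suc (suc p)) = hueFrom (suc i) p

  hue : ℕ → Fin k
  hue = hueFrom 0

  hueFrom-+ : ∀ i j r → hueFrom j (2 * i + r) ≡ hueFrom (i + j) r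
  hueFrom-+ zero j r = refl
  hueFrom-+ (suc i) j r = trans (cong (λ q → hueFrom j (q + r)) (*-suc 2 i))
    (trans (hueFrom-+ i (suc j) r) (cong (λ q → hueFrom q r) (+-suc i j)))

  hue-vertex : ∀ i → hue (2 * i) ≡ vcol (i mod n)
  hue-vertex i = trans (cong hue (sym (+-identityʳ (2 * i))))
    (trans (hueFrom-+ i 0 0) (cong (λ q → hueFrom q 0) (+-identityʳ i)))

  hue-edge : ∀ i → hue (suc (2 * i)) ≡ acol (i mod n) (suc i mod n)
  hue-edge i = trans (cong hue (+-comm 1 (2 * i)))
    (trans (hueFrom-+ i 0 1) (cong (λ q → hueFrom q 1) (+-identityʳ i)))

  hue-periodic : ∀ p → hue (p + 2 * n) ≡ hue p
  hue-periodic p with even⊎odd p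
  ... | inj₁ (i , refl) = trans (cong hue (sym (*-distribˡ-+ 2 i n)))
    (trans (hue-vertex (i + n)) (trans (cong vcol (mod-+n i)) (sym (hue-vertex i))))
  ... | inj₂ (i , refl) = trans (cong (hue ∘ suc) (sym (*-distribˡ-+ 2 i n)))
    (trans (hue-edge (i + n)) (trans (cong₂ acol (mod-+n i) (mod-+n (suc i))) (sym (hue-edge i))))

  module Window (s : ℕ) where
    M<n : M < n
    M<n = ≤-<-trans (m≤m+n M _) 2M<n

    u≢v : s mod n ≢ (M + s) mod n
    u≢v = mod-separated (m<n+m s 1≤M) (subst (M + s <_) (+-comm n s) (+-monoˡ-< s M<n))

    path : Path D (s mod n) ((M + s) mod n)
    path = proj₁ (proj₂ conn _ _ u≢v)

    rainbow : TotalRainbow D (proj₁ conn) path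
    rainbow = proj₂ (proj₂ (proj₂ conn _ _ u≢v))

    ℓ : ℕ
    ℓ = length D path

    2ℓ≤n : 2 * ℓ ≤ n
    2ℓ≤n = double ℓ (≤-<-trans (rainbow⇒length≤ (proj₁ conn) path rainbow) k<n)
      where
      double : ∀ ℓ → ℓ + (ℓ ∸ 1) < n → 2 * ℓ ≤ n
      double zero _ = z≤n
      double (suc ℓ) lt = ≤-trans (≤-reflexive (identity ℓ)) lt
        where
        identity : ∀ ℓ → 2 * suc ℓ ≡ suc (suc ℓ + ℓ)
        identity = solve-∀

    ℓ+M<n : ℓ + M < n
    ℓ+M<n = *-cancelˡ-< 2 (ℓ + M) n (subst₂ _<_ (sym (*-distribˡ-+ 2 ℓ M))
      (cong (n +_) (sym (+-identityʳ n))) (+-mono-≤-< 2ℓ≤n 2M<n))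

    ℓ≤n : ℓ ≤ n
    ℓ≤n = ≤-trans (m≤m+n ℓ M) (<⇒≤ ℓ+M<n)

    open Unrolled (unroll path (s + n) (mod-+n s) (≤-trans ℓ≤n (m≤n+m n s)))

    -- Fewer than `n` colours give `2 * ℓ ≤ n`. With `2 * M < n` this yields `ℓ + M < n`, which
    -- rules out the way round of `n − M` steps.
    end≡ : end ≡ M + (s + n)
    end≡ = residue-unique ℓ+M<n end≤ start≤ (trans end-mod (sym (mod-shift M s)))

    below-end : ∀ {i} → i < M + s → i + n < end
    below-end {i} i< = subst (i + n <_) (trans (+-assoc M s n) (sym end≡)) (+-monoˡ-< n i<)

    arc∈ : ∀ {i} → s ≤ i → i < M + s → (i mod n , suc i mod n) ∈ arcs D path
    arc∈ {i} s≤i i< = subst (_∈ arcs D path) (cong₂ _,_ (mod-+n i) (mod-+n (suc i)))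
      (arcs⊇ (i + n) (+-monoˡ-≤ n s≤i) (below-end i<))

    vertex∈ : ∀ {i} → s < i → i < M + s → i mod n ∈ internal D path
    vertex∈ {i} s<i i< = subst (_∈ internal D path) (mod-+n i)
      (internal⊇ (i + n) (+-monoˡ-< n s<i) (below-end i<))

    mod-≢ : ∀ {i j} → s ≤ i → i < j → j < M + s → i mod n ≢ j mod n
    mod-≢ {i} s≤i i<j j< = mod-separated i<j (<-≤-trans j<
      (≤-trans (+-mono-≤ (<⇒≤ M<n) s≤i) (≤-reflexive (+-comm n i))))

    vertex≢edge : ∀ {i j} → s < i → i < M + s → s ≤ j → j < M + s →
      vcol (i mod n) ≢ acol (j mod n) (suc j mod n)
    vertex≢edge s<i i< s≤j j< eq = unique-++⇒disjoint rainbow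
      (∈-map⁺ _ (arc∈ s≤j j<)) (∈-map⁺ vcol (vertex∈ s<i i<)) (sym eq)

    -- All inner half-steps of the window lie on the rainbow path. Equal colours of the same kind
    -- would force equal residues, and a vertex and an arc are separated by the two halves of the
    -- colour list.
    window-distinct : Distinct hue s M
    window-distinct p q 2s<p p<q q< eq with even⊎odd p | even⊎odd q
    ... | inj₁ (i , refl) | inj₁ (j , refl) =
      mod-≢ (<⇒≤ s<i) i<j j<
        (unique-map⇒injective (unique-++⁻ʳ (map _ (arcs D path)) rainbow)
          (vertex∈ s<i (<-trans i<j j<)) (vertex∈ (<-trans s<i i<j) j<)
          (trans (sym (hue-vertex i)) (trans eq (hue-vertex j))))
      where
      s<i : s < i
      s<i = *-cancelˡ-< 2 s i 2s<p
      i<j : i < j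
      i<j = *-cancelˡ-< 2 i j p<q
      j< : j < M + s
      j< = *-cancelˡ-< 2 j (M + s) q<
    ... | inj₁ (i , refl) | inj₂ (j , refl) =
      vertex≢edge s<i (≤-<-trans i≤j j<) (≤-trans (<⇒≤ s<i) i≤j) j<
        (trans (sym (hue-vertex i)) (trans eq (hue-edge j)))
      where
      s<i : s < i
      s<i = *-cancelˡ-< 2 s i 2s<p
      i≤j : i ≤ j
      i≤j = *-cancelˡ-≤ 2 (s≤s⁻¹ p<q)
      j< : j < M + s
      j< = *-cancelˡ-< 2 j (M + s) (<-trans (n<1+n _) q<)
    ... | inj₂ (i , refl) | inj₁ (j , refl) =
      vertex≢edge (≤-<-trans s≤i i<j) j< s≤i (<-trans i<j j<)
        (trans (sym (hue-vertex j)) (trans (sym eq) (hue-edge i)))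
      where
      s≤i : s ≤ i
      s≤i = *-cancelˡ-≤ 2 (s≤s⁻¹ 2s<p)
      i<j : i < j
      i<j = *-cancelˡ-< 2 i j (<-trans (n<1+n _) p<q)
      j< : j < M + s
      j< = *-cancelˡ-< 2 j (M + s) q<
    ... | inj₂ (i , refl) | inj₂ (j , refl) =
      mod-≢ s≤i i<j j<
        (cong proj₁ (unique-map⇒injective (unique-++⁻ˡ rainbow)
          (arc∈ s≤i (<-trans i<j j<)) (arc∈ (≤-trans s≤i (<⇒≤ i<j)) j<)
          (trans (sym (hue-edge i)) (trans eq (hue-edge j)))))
      where
      s≤i : s ≤ i
      s≤i = *-cancelˡ-≤ 2 (s≤s⁻¹ 2s<p)
      i<j : i < j
      i<j = *-cancelˡ-< 2 i j (s<s⁻¹ p<q)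
      j< : j < M + s
      j< = *-cancelˡ-< 2 j (M + s) (<-trans (n<1+n _) q<)

  -- Some M consecutive edges contain both half-steps p ≤ q in their interior.
  Near : ℕ → ℕ → Set
  Near p q = p < q × q + 2 < 2 * ⌈ p /2⌉ + 2 * M

  near⇒≢ : ∀ {p q} → Near p q → hue p ≢ hue q
  near⇒≢ {p} {q} (p<q , near) eq = Window.window-distinct s (p + 2 * n) (q + 2 * n)
    (≤-trans (≤-reflexive (left ⌈ p /2⌉ n-1)) (≤-trans (+-monoˡ-≤ n+n-1 2⌈p/2⌉≤) (≤-reflexive (left′ p n-1))))
    (+-monoˡ-< (2 * n) p<q)
    (≤-trans (≤-reflexive (right q n-1)) (≤-trans (+-monoˡ-≤ (2 * n-1) near) (≤-reflexive (right′ ⌈ p /2⌉ M n-1))))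
    (trans (hue-periodic p) (trans eq (sym (hue-periodic q))))
    where
    s n+n-1 : ℕ
    -- The last vertex strictly before position `p` is `⌈ p /2⌉ − 1`; a full turn is added because
    -- this is negative for `p = 0`.
    s = ⌈ p /2⌉ + n-1
    n+n-1 = n + n-1
    2⌈p/2⌉≤ : 2 * ⌈ p /2⌉ ≤ suc p
    2⌈p/2⌉≤ = subst₂ _≤_ (cong (⌈ p /2⌉ +_) (sym (+-identityʳ _))) (⌊n/2⌋+⌈n/2⌉≡n (suc p))
      (+-monoʳ-≤ ⌈ p /2⌉ (⌊n/2⌋≤⌈n/2⌉ (suc p)))
    left : ∀ c m → suc (2 * (c + m)) ≡ 2 * c + (suc m + m)
    left = solve-∀
    left′ : ∀ p m → suc p + (suc m + m) ≡ p + 2 * suc m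
    left′ = solve-∀
    right : ∀ q m → suc (q + 2 * suc m) ≡ suc (q + 2) + 2 * m
    right = solve-∀
    right′ : ∀ c M m → 2 * c + 2 * M + 2 * m ≡ 2 * (M + (c + m))
    right′ = solve-∀

  -- Replacing `2 * ⌈ x /2⌉` in `Near` by its lower bound `x` removes the dependence on parity; the
  -- searches for C₇ and C₉ keep the sharper form.
  same-hue⇒far : ∀ {x y} → x < y → hue x ≡ hue y → x + 2 * M ≤ y + 2
  same-hue⇒far {x} x<y eq = ≮⇒≥ λ y+2< →
    near⇒≢ (x<y , <-≤-trans y+2< (+-monoˡ-≤ (2 * M) x≤2⌈x/2⌉)) eq
    where
    x≤2⌈x/2⌉ : x ≤ 2 * ⌈ x /2⌉
    x≤2⌈x/2⌉ = subst₂ _≤_ (⌊n/2⌋+⌈n/2⌉≡n x) (cong (⌈ x /2⌉ +_) (sym (+-identityʳ _)))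
      (+-monoˡ-≤ ⌈ x /2⌉ (⌊n/2⌋≤⌈n/2⌉ x))

  -- Three gaps of at least 2M − 2 half-steps do not fit into a cycle of 2n half-steps.
  no-triple-hue : n + 3 < 3 * M →
    ∀ {x y z} → x < y → y < z → z < 2 * n → hue x ≡ hue y → hue y ≢ hue z
  no-triple-hue n+3<3M {x} {y} {z} x<y y<z z<2n x≡y y≡z =
    ≰-by 1 (identity x y z n M)
      (+-mono-≤ (+-mono-≤ (same-hue⇒far x<y x≡y) (same-hue⇒far y<z y≡z))
        -- The third gap runs from `z` to the copy of `x` one turn later.
        (+-mono-≤ (same-hue⇒far (<-≤-trans z<2n (m≤n+m (2 * n) x))
            (sym (trans (hue-periodic x) (trans x≡y y≡z))))
          (*-monoʳ-≤ 2 n+3<3M)))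
    where
    identity : ∀ x y z n M → x + 2 * M + (y + 2 * M) + (z + 2 * M + 2 * suc (n + 3)) ≡
      suc (1 + (y + 2 + (z + 2) + (x + 2 * n + 2 + 2 * (3 * M))))
    identity = solve-∀

-- Lower bounds for cycles

cycle-lower-diameter : ∀ {j} n-1 L → 0 < L → 2 * L ≤ suc n-1 →
  TRConnected (biorient (C (suc n-1))) j → L + (L ∸ 1) ≤ j
cycle-lower-diameter n-1 L 0<L 2L≤n = distance⇒≤ L
  (mod-separated (m<n+m 0 0<L) (subst (_< n) (sym (+-identityʳ L)) (<-≤-trans (m<m+n L (≤-trans 0<L (m≤m+n L 0))) 2L≤n)))
  (distance-forward 0 L 2L≤n)
  where open Cycle n-1

module _ (n-1 M : ℕ) (1≤M : 1 ≤ M) (2M<n : 2 * M < suc n-1) where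
  -- With `j < n` colours each one would occur at most twice among `2 * n` half-steps, whence
  -- `2 * n ≤ 2 * j`.
  cycle-lower-general : suc n-1 + 3 < 3 * M →
    ∀ j → TRConnected (biorient (C (suc n-1))) j → suc n-1 ≤ j
  cycle-lower-general n+3<3M j conn = ≮⇒≥ λ j<n →
    let open CycleLower n-1 j<n conn M 1≤M 2M<n in
    <⇒≱ j<n (*-cancelʳ-≤ n j 2 (subst (_≤ j * 2) (*-comm 2 n)
      (no-triple⇒≤ hue (2 * n) (no-triple-hue n+3<3M))))
    where
    n : ℕ
    n = suc n-1

  module _ (w : ℕ → ℕ) (b : ℕ) where
    private
      n N : ℕ
      n = suc n-1
      N = 2 * n

      near? : ℕ → ℕ → Bool
      near? p q = (p <ᵇ q) ∧ (q + 2 <ᵇ 2 * ⌈ p /2⌉ + 2 * M)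

      -- The second alternative looks across the seam, from `q` to the copy of `p` one turn later.
      conflict : ℕ → ℕ → Bool
      conflict p q = near? p q ∨ near? q (p + N)

    open Search w conflict

    -- The search runs during type checking and bounds the weight of every possible colour class by
    -- `b`; `j` classes share the total weight.
    light⇒total≤ : T (light (downFrom N) [] b) → ∀ {j} → j < n →
      TRConnected (biorient (C n)) j → total (map w (downFrom N)) ≤ j * b
    light⇒total≤ l j<n conn = Load.load≤⇒sum≤ hue w (downFrom N) b
      λ c → light⇒load≤ hue conflict⇒hue≢ (downFrom N) [] b l []
      where
      open CycleLower n-1 j<n conn M 1≤M 2M<n

      near?⇒hue≢ : ∀ p q → T (near? p q) → hue p ≢ hue q
      near?⇒hue≢ p q t with Equivalence.to (T-∧ {p <ᵇ q}) t
      ... | p<q , near = near⇒≢ (<ᵇ⇒< p q p<q , <ᵇ⇒< _ _ near)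

      conflict⇒hue≢ : ∀ p q → T (conflict p q) → hue p ≢ hue q
      conflict⇒hue≢ p q t with Equivalence.to (T-∨ {near? p q}) t
      ... | inj₁ pq = near?⇒hue≢ p q pq
      ... | inj₂ qp = λ eq → near?⇒hue≢ q (p + N) qp (sym (trans (hue-periodic p) eq))

-- A colour used on a arcs and b vertices satisfies 2a + b ≤ 4, so five colours cover at most 20 of
-- the total weight 21.
C7-lower : ∀ j → TRConnected (biorient (C 7)) j → 6 ≤ j
C7-lower j conn = ≮⇒≥ λ j<6 → <⇒≱ (n<1+n 20)
  (≤-trans (light⇒total≤ 6 3 (s≤s z≤n) (n<1+n 6) (λ p → 1 + p % 2) 4 _ (<-trans j<6 (n<1+n 6)) conn)
    (*-monoˡ-≤ 4 (s≤s⁻¹ j<6)))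

-- Likewise 3a + 2b ≤ 6, so seven colours cover at most 42 of the total weight 45.
C9-lower : ∀ j → TRConnected (biorient (C 9)) j → 8 ≤ j
C9-lower j conn = ≮⇒≥ λ j<8 → <⇒≱ (s≤s (m≤n+m 42 2))
  (≤-trans (light⇒total≤ 8 4 (s≤s z≤n) (n<1+n 8) (λ p → 2 + p % 2) 6 _ (<-trans j<8 (n<1+n 8)) conn)
    (*-monoˡ-≤ 6 (s≤s⁻¹ j<8)))

cycle-lower-large : ∀ m j → TRConnected (biorient (C (13 + m))) j → 13 + m ≤ j
cycle-lower-large m = cycle-lower-general (12 + m) M (s≤s z≤n) 2M<n n+3<3M
  where
  M : ℕ
  -- The greatest `M` with `2 * M < 13 + m`.
  M = 6 + ⌊ m /2⌋
  2M<n : 2 * M < 13 + m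
  2M<n = ≤-trans (≤-reflexive (identity ⌊ m /2⌋))
    (+-monoʳ-≤ 13 (≤-trans (+-monoʳ-≤ ⌊ m /2⌋ (⌊n/2⌋≤⌈n/2⌉ m)) (≤-reflexive (⌊n/2⌋+⌈n/2⌉≡n m))))
    where
    identity : ∀ h → suc (2 * (6 + h)) ≡ 13 + (h + h)
    identity = solve-∀
  n+3<3M : 13 + m + 3 < 3 * M
  n+3<3M = ≤-trans (≤-reflexive (cong suc (identity m)))
    (≤-trans (+-monoʳ-≤ 17 m≤) (≤-trans (m≤n+m _ (⌊ m /2⌋)) (≤-reflexive (identity′ ⌊ m /2⌋))))
    where
    m≤ : m ≤ suc (⌊ m /2⌋ + ⌊ m /2⌋)
    m≤ = ≤-trans (≤-reflexive (sym (⌊n/2⌋+⌈n/2⌉≡n m)))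
      (≤-trans (+-monoʳ-≤ ⌊ m /2⌋ (⌈n/2⌉≤ m)) (≤-reflexive (+-suc _ _)))
      where
      ⌈n/2⌉≤ : ∀ n → ⌈ n /2⌉ ≤ suc ⌊ n /2⌋
      ⌈n/2⌉≤ zero = z≤n
      ⌈n/2⌉≤ (suc zero) = ≤-refl
      ⌈n/2⌉≤ (suc (suc n)) = s≤s (⌈n/2⌉≤ n)
    identity : ∀ m → 13 + m + 3 ≡ 16 + m
    identity = solve-∀
    identity′ : ∀ h → h + (17 + suc (h + h)) ≡ 3 * (6 + h)
    identity′ = solve-∀

-- Exact values for cycles

cycle-theorem : ∀ n → 3 ≤ n → trc≡ (biorient (C n)) (g n) × strc≡ (biorient (C n)) (g n)
cycle-theorem 0 ()
cycle-theorem 1 (s≤s ())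
cycle-theorem 2 (s≤s (s≤s ()))
-- Wherever `cycle-lower-diameter` is used, the length given to it is the diameter `⌊ n /2⌋`, which
-- forces `2 * ⌊ n /2⌋ − 1` colours.
cycle-theorem 3 _ = trc×strc C3-connected λ _ → cycle-lower-diameter 2 1 z<s (n≤1+n 2)
cycle-theorem 4 _ = trc×strc C4-connected λ _ → cycle-lower-diameter 3 2 z<s ≤-refl
cycle-theorem 5 _ = trc×strc C5-connected λ _ → cycle-lower-diameter 4 2 z<s (n≤1+n 4)
cycle-theorem 6 _ = trc×strc C6-connected λ _ → cycle-lower-diameter 5 3 z<s ≤-refl
cycle-theorem 7 _ = trc×strc C7-connected C7-lower
cycle-theorem 8 _ = trc×strc C8-connected λ _ → cycle-lower-diameter 7 4 z<s ≤-refl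
cycle-theorem 9 _ = trc×strc C9-connected C9-lower
cycle-theorem 10 _ = trc×strc C10-connected λ _ → cycle-lower-diameter 9 5 z<s ≤-refl
-- Here `M = 5`, and `11 + 3 < 15` holds with nothing to spare. For 12 the greatest admissible `M`
-- is still 5 and the inequality fails; from 13 on it holds again.
cycle-theorem 11 3≤n = trc×strc (cycle-connected-n 10 3≤n)
  (cycle-lower-general 10 5 z<s ≤-refl ≤-refl)
cycle-theorem 12 _ = trc×strc C12-connected λ _ → cycle-lower-diameter 11 6 z<s ≤-refl
cycle-theorem (suc (suc (suc (suc (suc (suc (suc (suc (suc (suc (suc (suc (suc m))))))))))))) 3≤n =
  trc×strc (cycle-connected-n (12 + m) 3≤n) (cycle-lower-large m)

theorem9 : ((n : ℕ) → 2 ≤ n →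
    trc≡ (biorient (P n)) (2 * n ∸ 3) × strc≡ (biorient (P n)) (2 * n ∸ 3))
    × ((n : ℕ) → 3 ≤ n →
    trc≡ (biorient (C n)) (g n) × strc≡ (biorient (C n)) (g n))
    × ((n : ℕ) → 4 ≤ n →
    trc≡ (biorient (W n)) 3 × strc≡ (biorient (W n)) 3)
    × ((t : ℕ) (ns : Fin t → ℕ) → 2 ≤ t → ((i : Fin t) → 1 ≤ ns i) →
    (∃[ i ] 2 ≤ ns i) →
    trc≡ (biorient (K t ns)) 3 × strc≡ (biorient (K t ns)) 3)
theorem9 = path-theorem , cycle-theorem , wheel-theorem , multipartite-theorem
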